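{- Let $k$ be a field, let $n,d$ be positive integers, let $R_d^n=k[x_1,\dots,x_n]/\mathfrak{m}^d$ where $\mathfrak{m}=(x_1,\dots,x_n)$, and let $S$ be any finite set of ideals of $R_d^n$. Then the Hilbert--Dyck series $$\mathrm{HD}_d(t):=\sum_{w\in\mathcal{D}(S)}\dim_k\bigl(\mathrm{Spl}_{R_d^n}(T(w))\bigr)\,t^{|E_{T(w)}|}$$ is algebraic.
   Context: The Dyck language $\mathcal{D}(S)$ is the set of words (including the empty word) in the alphabet $\{(_\alpha,\,)_\alpha\mid\alpha\in S\}$ that are properly nested sequences of parentheses, each left parenthesis being closed by a right parenthesis with the same label. For $w\in\mathcal{D}(S)$ the planar rooted tree $T(w)$ with edge-labels in $S$ is defined recursively: the empty word gives the one-vertex tree; if $w=(_{\alpha_1}w_1)_{\alpha_1}\cdots(_{\alpha_m}w_m)_{\alpha_m}$ with $w_i\in\mathcal{D}(S)$, then $T(w)$ has $m$ edges out of its root, labeled $\alpha_1,\dots,\alpha_m$ from left to right, the $i$-th one attached to the root of $T(w_i)$. This is a bijection between $\mathcal{D}(S)$ and planar rooted trees with edge-labels in $S$; $|E_{T(w)}|$, the number of edges of $T(w)$, is half the length of $w$. For a commutative ring $R$ and a tree $T$ with vertex set $V_T$ and edges labeled by ideals of $R$ via $\alpha$, $\mathrm{Spl}_R(T)$ is the $R$-module of all $\mathbf p\in\bigoplus_{v\in V_T}R$ with $\mathbf p_u-\mathbf p_v\in\alpha(e)$ for each edge $e$ with endpoints $u,v$. A formal power series $F(t)$ is algebraic if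 there is a nonzero polynomial $P(x,t)$ with rational coefficients such that $P(F(t),t)=0$. -}

module Defs where

open import Level using (0ℓ; _⊔_; Lift; lift) renaming (suc to lsuc)
open import Algebra.Bundles using (CommutativeRing; AbelianGroup)
open import Algebra.Structures using (IsAbelianGroup)
open import Algebra.Apartness.Bundles using (HeytingField; HeytingCommutativeRing)
open import Algebra.Module.Bundles using (Module)
open import Algebra.Module.Structures.Biased using (IsModuleFromLeft)
open import Algebra.Module.Construct.TensorUnit using (⟨module⟩)
open import Algebra.Morphism.Bundles using (RingHomomorphism)
import Algebra.Morphism.Construct.Composition as Composition
import Algebra.Morphism.Construct.Identity as Identity
import Algebra.Definitions.RawMonoid as RawMonoidDefs
import Algebra.Properties.AbelianGroup as AbelianGroupProperties
import Algebra.Properties.Ring as RingProperties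
import Algebra.Properties.CommutativeSemigroup as CommutativeSemigroupProperties
open import Data.Fin.Base using (Fin; zero; suc; toℕ)
open import Data.Integer.Base using (+_)
open import Data.List.Base using (List; []; _∷_; _++_; map; length; lookup; concatMap; cartesianProductWith; upTo; allFin)
open import Data.Nat.ListAction using (sum)
open import Data.List.Properties using (∷-injectiveˡ; ∷-injectiveʳ; ++-assoc)
open import Data.List.Membership.Propositional using (_∈_; lose; find)
open import Data.List.Membership.Propositional.Properties using (∈-concatMap⁺; ∈-concatMap⁻; ∈-cartesianProductWith⁺; ∈-cartesianProductWith⁻; ∈-upTo⁺; ∈-upTo⁻; ∈-allFin)
open import Data.List.Relation.Unary.All as All using ()
open import Data.List.Relation.Unary.AllPairs as AllPairs using ()
open import Data.List.Relation.Unary.Any using (here; there)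
import Data.List.Relation.Unary.All.Properties as Allₚ
import Data.List.Relation.Unary.AllPairs.Properties as AllPairsₚ
open import Data.List.Relation.Unary.Unique.Propositional using (Unique)
import Data.List.Relation.Unary.Unique.Propositional.Properties as Uniqueₚ
open import Data.Nat.Base using (ℕ; zero; suc; _∸_; _≤_; z≤n; s≤s; s≤s⁻¹) renaming (_+_ to _+ℕ_)
open import Data.Nat.Properties using (≤-trans; ≤-refl; m≤m+n; m≤n+m; m+n∸m≡n; m+[n∸m]≡n)
open import Data.Product.Base using (Σ; ∃; _×_; _,_; proj₁; proj₂)
open import Data.Rational.Base as ℚ using (ℚ; _/_)
import Data.Rational.Properties as ℚₚ
open import Data.Unit.Base using (⊤; tt)
open import Relation.Binary.Core using (Rel)
open import Relation.Binary.PropositionalEquality as ≡ using (_≡_)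
open import Relation.Nullary.Negation using (¬_)
open import Relation.Unary using (Pred; _≐_)

-- A list is the polynomial with those coefficients, constant term first;
-- trailing zeros are harmless because equality is coefficientwise.

module Poly {c ℓ} (A : CommutativeRing c ℓ) where

  private
    module A = CommutativeRing A
    open A using (Carrier; _≈_; 0#; 1#)
    open RingProperties A.ring using (-0#≈0#)
    open import Relation.Binary.Reasoning.Setoid A.setoid

  Polynomial : Set c
  Polynomial = List Carrier

  coeff : Polynomial → ℕ → Carrier
  coeff []      _       = 0#
  coeff (a ∷ p) zero    = a
  coeff (a ∷ p) (suc i) = coeff p i

  infix  4 _≈ₚ_
  infixl 6 _+ₚ_
  infixl 7 _*ₚ_
  infix  8 -ₚ_

  record _≈ₚ_ (p q : Polynomial) : Set ℓ where
    constructor coeffwise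
    field at : ∀ i → coeff p i ≈ coeff q i

  open _≈ₚ_ public

  _+ₚ_ : Polynomial → Polynomial → Polynomial
  []      +ₚ q       = q
  (a ∷ p) +ₚ []      = a ∷ p
  (a ∷ p) +ₚ (b ∷ q) = a A.+ b ∷ p +ₚ q

  -ₚ_ : Polynomial → Polynomial
  -ₚ_ = map (λ a → A.- a)

  scale : Carrier → Polynomial → Polynomial
  scale a = map (a A.*_)

  _*ₚ_ : Polynomial → Polynomial → Polynomial
  []      *ₚ q = []
  (a ∷ p) *ₚ q = scale a q +ₚ (0# ∷ p *ₚ q)

  constant : Carrier → Polynomial
  constant a = a ∷ []

  indeterminate : Polynomial
  indeterminate = 0# ∷ 1# ∷ []

  coeff-+ : ∀ p q i → coeff (p +ₚ q) i ≈ coeff p i A.+ coeff q i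
  coeff-+ []      q       i       = A.sym (A.+-identityˡ _)
  coeff-+ (a ∷ p) []      i       = A.sym (A.+-identityʳ _)
  coeff-+ (a ∷ p) (b ∷ q) zero    = A.refl
  coeff-+ (a ∷ p) (b ∷ q) (suc i) = coeff-+ p q i

  coeff-neg : ∀ p i → coeff (-ₚ p) i ≈ A.- coeff p i
  coeff-neg []      i       = A.sym -0#≈0#
  coeff-neg (a ∷ p) zero    = A.refl
  coeff-neg (a ∷ p) (suc i) = coeff-neg p i

  coeff-scale : ∀ a p i → coeff (scale a p) i ≈ a A.* coeff p i
  coeff-scale a []      i       = A.sym (A.zeroʳ a)
  coeff-scale a (b ∷ p) zero    = A.refl
  coeff-scale a (b ∷ p) (suc i) = coeff-scale a p i

  private
    reflₚ : ∀ {p} → p ≈ₚ p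
    reflₚ .at i = A.refl

    symₚ : ∀ {p q} → p ≈ₚ q → q ≈ₚ p
    symₚ e .at i = A.sym (e .at i)

    transₚ : ∀ {p q r} → p ≈ₚ q → q ≈ₚ r → p ≈ₚ r
    transₚ e f .at i = A.trans (e .at i) (f .at i)

    +-congₚ : ∀ {p p′ q q′} → p ≈ₚ p′ → q ≈ₚ q′ → p +ₚ q ≈ₚ p′ +ₚ q′
    +-congₚ {p} {p′} {q} {q′} e f .at i = begin
      coeff (p +ₚ q) i           ≈⟨ coeff-+ p q i ⟩
      coeff p i A.+ coeff q i    ≈⟨ A.+-cong (e .at i) (f .at i) ⟩
      coeff p′ i A.+ coeff q′ i  ≈⟨ coeff-+ p′ q′ i ⟨
      coeff (p′ +ₚ q′) i         ∎

    +-assocₚ : ∀ p q r → (p +ₚ q) +ₚ r ≈ₚ p +ₚ (q +ₚ r)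
    +-assocₚ p q r .at i = begin
      coeff ((p +ₚ q) +ₚ r) i                  ≈⟨ coeff-+ (p +ₚ q) r i ⟩
      coeff (p +ₚ q) i A.+ coeff r i           ≈⟨ A.+-congʳ (coeff-+ p q i) ⟩
      (coeff p i A.+ coeff q i) A.+ coeff r i  ≈⟨ A.+-assoc _ _ _ ⟩
      coeff p i A.+ (coeff q i A.+ coeff r i)  ≈⟨ A.+-congˡ (coeff-+ q r i) ⟨
      coeff p i A.+ coeff (q +ₚ r) i           ≈⟨ coeff-+ p (q +ₚ r) i ⟨
      coeff (p +ₚ (q +ₚ r)) i                  ∎

    +-commₚ : ∀ p q → p +ₚ q ≈ₚ q +ₚ p
    +-commₚ p q .at i = begin
      coeff (p +ₚ q) i         ≈⟨ coeff-+ p q i ⟩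
      coeff p i A.+ coeff q i  ≈⟨ A.+-comm _ _ ⟩
      coeff q i A.+ coeff p i  ≈⟨ coeff-+ q p i ⟨
      coeff (q +ₚ p) i         ∎

    +-identityʳₚ : ∀ p → p +ₚ [] ≈ₚ p
    +-identityʳₚ p .at i = A.trans (coeff-+ p [] i) (A.+-identityʳ _)

    -‿inverseˡₚ : ∀ p → (-ₚ p) +ₚ p ≈ₚ []
    -‿inverseˡₚ p .at i = begin
      coeff ((-ₚ p) +ₚ p) i         ≈⟨ coeff-+ (-ₚ p) p i ⟩
      coeff (-ₚ p) i A.+ coeff p i  ≈⟨ A.+-congʳ (coeff-neg p i) ⟩
      A.- coeff p i A.+ coeff p i   ≈⟨ A.-‿inverseˡ _ ⟩
      0#                            ∎

    -‿congₚ : ∀ {p q} → p ≈ₚ q → -ₚ p ≈ₚ -ₚ q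
    -‿congₚ {p} {q} e .at i = begin
      coeff (-ₚ p) i  ≈⟨ coeff-neg p i ⟩
      A.- coeff p i   ≈⟨ A.-‿cong (e .at i) ⟩
      A.- coeff q i   ≈⟨ coeff-neg q i ⟨
      coeff (-ₚ q) i  ∎

  +ₚ-isAbelianGroup : IsAbelianGroup _≈ₚ_ _+ₚ_ [] -ₚ_
  +ₚ-isAbelianGroup = record
    { isGroup = record
      { isMonoid = record
        { isSemigroup = record
          { isMagma = record
            { isEquivalence = record { refl = reflₚ ; sym = symₚ ; trans = transₚ }
            ; ∙-cong        = +-congₚ
            }
          ; assoc = +-assocₚ
          }
        ; identity = (λ _ → reflₚ) , +-identityʳₚ
        }
      ; inverse = -‿inverseˡₚ , λ p → transₚ (+-commₚ p (-ₚ p)) (-‿inverseˡₚ p)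
      ; ⁻¹-cong = -‿congₚ
      }
    ; comm = +-commₚ
    }

  private
    +ₚ-abelianGroup : AbelianGroup c ℓ
    +ₚ-abelianGroup = record { isAbelianGroup = +ₚ-isAbelianGroup }

    module P = AbelianGroup +ₚ-abelianGroup
    open CommutativeSemigroupProperties P.commutativeSemigroup using (interchange; x∙yz≈y∙xz)
    module ≈ₚ where
      open import Relation.Binary.Reasoning.Setoid P.setoid public

    shift : Polynomial → Polynomial
    shift p = 0# ∷ p

    ∷-cong : ∀ {a b p q} → a ≈ b → p ≈ₚ q → a ∷ p ≈ₚ b ∷ q
    ∷-cong e f .at zero    = e
    ∷-cong e f .at (suc i) = f .at i

    shift-[] : shift [] ≈ₚ []
    shift-[] .at zero    = A.refl
    shift-[] .at (suc i) = A.refl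

    shift-+ : ∀ p q → shift (p +ₚ q) ≈ₚ shift p +ₚ shift q
    shift-+ p q = ∷-cong (A.sym (A.+-identityˡ 0#)) reflₚ

    scale-cong : ∀ {a b p q} → a ≈ b → p ≈ₚ q → scale a p ≈ₚ scale b q
    scale-cong {a} {b} {p} {q} e f .at i = begin
      coeff (scale a p) i  ≈⟨ coeff-scale a p i ⟩
      a A.* coeff p i      ≈⟨ A.*-cong e (f .at i) ⟩
      b A.* coeff q i      ≈⟨ coeff-scale b q i ⟨
      coeff (scale b q) i  ∎

    scale-+ : ∀ a p q → scale a (p +ₚ q) ≈ₚ scale a p +ₚ scale a q
    scale-+ a p q .at i = begin
      coeff (scale a (p +ₚ q)) i                  ≈⟨ coeff-scale a (p +ₚ q) i ⟩
      a A.* coeff (p +ₚ q) i                      ≈⟨ A.*-congˡ (coeff-+ p q i) ⟩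
      a A.* (coeff p i A.+ coeff q i)             ≈⟨ A.distribˡ _ _ _ ⟩
      a A.* coeff p i A.+ a A.* coeff q i         ≈⟨ A.+-cong (coeff-scale a p i) (coeff-scale a q i) ⟨
      coeff (scale a p) i A.+ coeff (scale a q) i ≈⟨ coeff-+ (scale a p) (scale a q) i ⟨
      coeff (scale a p +ₚ scale a q) i            ∎

    scale-scale : ∀ a b p → scale (a A.* b) p ≈ₚ scale a (scale b p)
    scale-scale a b p .at i = begin
      coeff (scale (a A.* b) p) i      ≈⟨ coeff-scale (a A.* b) p i ⟩
      a A.* b A.* coeff p i            ≈⟨ A.*-assoc _ _ _ ⟩
      a A.* (b A.* coeff p i)          ≈⟨ A.*-congˡ (coeff-scale b p i) ⟨
      a A.* coeff (scale b p) i        ≈⟨ coeff-scale a (scale b p) i ⟨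
      coeff (scale a (scale b p)) i    ∎

    scale-0 : ∀ p → scale 0# p ≈ₚ []
    scale-0 p .at i = A.trans (coeff-scale 0# p i) (A.zeroˡ _)

    scale-1 : ∀ p → scale 1# p ≈ₚ p
    scale-1 p .at i = A.trans (coeff-scale 1# p i) (A.*-identityˡ _)

    *-zeroʳₚ : ∀ p → p *ₚ [] ≈ₚ []
    *-zeroʳₚ []      = reflₚ
    *-zeroʳₚ (a ∷ p) = transₚ (∷-cong A.refl (*-zeroʳₚ p)) shift-[]

    *-∷ : ∀ q a p → q *ₚ (a ∷ p) ≈ₚ scale a q +ₚ shift (q *ₚ p)
    *-∷ []      a p = symₚ shift-[]
    *-∷ (b ∷ q) a p = ∷-cong (A.+-congʳ (A.*-comm b a)) (≈ₚ.begin
      scale b p +ₚ q *ₚ (a ∷ p)                   ≈ₚ.≈⟨ P.∙-congˡ (*-∷ q a p) ⟩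
      scale b p +ₚ (scale a q +ₚ shift (q *ₚ p))  ≈ₚ.≈⟨ x∙yz≈y∙xz (scale b p) (scale a q) (shift (q *ₚ p)) ⟩
      scale a q +ₚ (scale b p +ₚ shift (q *ₚ p))  ≈ₚ.∎)

    *-commₚ : ∀ p q → p *ₚ q ≈ₚ q *ₚ p
    *-commₚ []      q = symₚ (*-zeroʳₚ q)
    *-commₚ (a ∷ p) q = transₚ (P.∙-congˡ (∷-cong A.refl (*-commₚ p q))) (symₚ (*-∷ q a p))

    *-congˡₚ : ∀ p {q q′} → q ≈ₚ q′ → p *ₚ q ≈ₚ p *ₚ q′
    *-congˡₚ []      e = reflₚ
    *-congˡₚ (a ∷ p) e = +-congₚ (scale-cong A.refl e) (∷-cong A.refl (*-congˡₚ p e))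

    *-congʳₚ : ∀ {p p′} q → p ≈ₚ p′ → p *ₚ q ≈ₚ p′ *ₚ q
    *-congʳₚ {p} {p′} q e = transₚ (*-commₚ p q) (transₚ (*-congˡₚ q e) (*-commₚ q p′))

    distribˡₚ : ∀ p q r → p *ₚ (q +ₚ r) ≈ₚ p *ₚ q +ₚ p *ₚ r
    distribˡₚ []      q r = reflₚ
    distribˡₚ (a ∷ p) q r = ≈ₚ.begin
      scale a (q +ₚ r) +ₚ shift (p *ₚ (q +ₚ r))
        ≈ₚ.≈⟨ +-congₚ (scale-+ a q r) (∷-cong A.refl (distribˡₚ p q r)) ⟩
      (scale a q +ₚ scale a r) +ₚ shift (p *ₚ q +ₚ p *ₚ r)
        ≈ₚ.≈⟨ P.∙-congˡ (shift-+ (p *ₚ q) (p *ₚ r)) ⟩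
      (scale a q +ₚ scale a r) +ₚ (shift (p *ₚ q) +ₚ shift (p *ₚ r))
        ≈ₚ.≈⟨ interchange (scale a q) (scale a r) (shift (p *ₚ q)) (shift (p *ₚ r)) ⟩
      (scale a q +ₚ shift (p *ₚ q)) +ₚ (scale a r +ₚ shift (p *ₚ r))
        ≈ₚ.∎

    distribʳₚ : ∀ p q r → (q +ₚ r) *ₚ p ≈ₚ q *ₚ p +ₚ r *ₚ p
    distribʳₚ p q r = ≈ₚ.begin
      (q +ₚ r) *ₚ p     ≈ₚ.≈⟨ *-commₚ (q +ₚ r) p ⟩
      p *ₚ (q +ₚ r)     ≈ₚ.≈⟨ distribˡₚ p q r ⟩
      p *ₚ q +ₚ p *ₚ r  ≈ₚ.≈⟨ +-congₚ (*-commₚ p q) (*-commₚ p r) ⟩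
      q *ₚ p +ₚ r *ₚ p  ≈ₚ.∎

    scale-* : ∀ a q r → scale a q *ₚ r ≈ₚ scale a (q *ₚ r)
    scale-* a []      r = reflₚ
    scale-* a (b ∷ q) r = ≈ₚ.begin
      scale (a A.* b) r +ₚ shift (scale a q *ₚ r)
        ≈ₚ.≈⟨ +-congₚ (scale-scale a b r) (∷-cong (A.sym (A.zeroʳ a)) (scale-* a q r)) ⟩
      scale a (scale b r) +ₚ scale a (shift (q *ₚ r))
        ≈ₚ.≈⟨ scale-+ a (scale b r) (shift (q *ₚ r)) ⟨
      scale a (scale b r +ₚ shift (q *ₚ r))
        ≈ₚ.∎

    *-assocₚ : ∀ p q r → (p *ₚ q) *ₚ r ≈ₚ p *ₚ (q *ₚ r)
    *-assocₚ []      q r = reflₚ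
    *-assocₚ (a ∷ p) q r = ≈ₚ.begin
      (scale a q +ₚ shift (p *ₚ q)) *ₚ r
        ≈ₚ.≈⟨ distribʳₚ r (scale a q) (shift (p *ₚ q)) ⟩
      scale a q *ₚ r +ₚ (scale 0# r +ₚ shift (p *ₚ q *ₚ r))
        ≈ₚ.≈⟨ +-congₚ (scale-* a q r) (P.∙-congʳ (scale-0 r)) ⟩
      scale a (q *ₚ r) +ₚ shift (p *ₚ q *ₚ r)
        ≈ₚ.≈⟨ P.∙-congˡ (∷-cong A.refl (*-assocₚ p q r)) ⟩
      scale a (q *ₚ r) +ₚ shift (p *ₚ (q *ₚ r))
        ≈ₚ.∎

    *-identityˡₚ : ∀ p → constant 1# *ₚ p ≈ₚ p
    *-identityˡₚ p = ≈ₚ.begin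
      scale 1# p +ₚ shift []  ≈ₚ.≈⟨ +-congₚ (scale-1 p) shift-[] ⟩
      p +ₚ []                 ≈ₚ.≈⟨ +-identityʳₚ p ⟩
      p                       ≈ₚ.∎

  commutativeRing : CommutativeRing c ℓ
  commutativeRing = record
    { _≈_ = _≈ₚ_
    ; _+_ = _+ₚ_
    ; _*_ = _*ₚ_
    ; -_  = -ₚ_
    ; 0#  = []
    ; 1#  = constant 1#
    ; isCommutativeRing = record
      { isRing = record
        { +-isAbelianGroup = +ₚ-isAbelianGroup
        ; *-cong           = λ {p} {p′} {q} {q′} e f → transₚ (*-congʳₚ q e) (*-congˡₚ p′ f)
        ; *-assoc          = *-assocₚ
        ; *-identity       = *-identityˡₚ , λ p → transₚ (*-commₚ p (constant 1#)) (*-identityˡₚ p)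
        ; distrib          = distribˡₚ , distribʳₚ
        }
      ; *-comm = *-commₚ
      }
    }

  constantHomomorphism : RingHomomorphism A.rawRing (CommutativeRing.rawRing commutativeRing)
  constantHomomorphism = record
    { ⟦_⟧ = constant
    ; isRingHomomorphism = record
      { isSemiringHomomorphism = record
        { isNearSemiringHomomorphism = record
          { +-isMonoidHomomorphism = record
            { isMagmaHomomorphism = record
              { isRelHomomorphism = record { cong = λ e → ∷-cong e reflₚ }
              ; homo              = λ _ _ → reflₚ
              }
            ; ε-homo = shift-[]
            }
          ; *-homo = λ _ _ → ∷-cong (A.sym (A.+-identityʳ _)) reflₚ
          }
        ; 1#-homo = reflₚ
        }
      ; -‿homo = λ _ → reflₚ
      }
    }

-- A[x₁,…,xₙ] as an n-fold iterated univariate polynomial ring.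

module MultiPoly {c ℓ} (A : CommutativeRing c ℓ) where

  open CommutativeRing using (Carrier; rawRing; ring)

  polynomials : ℕ → CommutativeRing c ℓ
  polynomials zero    = A
  polynomials (suc n) = Poly.commutativeRing (polynomials n)

  constants : ∀ n → RingHomomorphism (rawRing A) (rawRing (polynomials n))
  constants zero    = Identity.ringHomomorphism (ring A)
  constants (suc n) =
    Composition.ringHomomorphism {M₁ = ring A} {ring (polynomials n)} {ring (polynomials (suc n))}
      (constants n) (Poly.constantHomomorphism (polynomials n))

  variables : ∀ n → Fin n → Carrier (polynomials n)
  variables (suc n) zero    = Poly.indeterminate (polynomials n)
  variables (suc n) (suc i) = Poly.constant (polynomials n) (variables n i)

record Submodule {r ℓr m ℓm} {A : CommutativeRing r ℓr} (M : Module A m ℓm) p : Set (r ⊔ m ⊔ ℓm ⊔ lsuc p) where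
  open Module M
  field
    Member    : Pred Carrierᴹ p
    resp      : ∀ {x y} → x ≈ᴹ y → Member x → Member y
    0-closed  : Member 0ᴹ
    +-closed  : ∀ {x y} → Member x → Member y → Member (x +ᴹ y)
    *ₗ-closed : ∀ a {x} → Member x → Member (a *ₗ x)

  -ᴹ-closed : ∀ {x} → Member x → Member (-ᴹ x)
  -ᴹ-closed {x} x∈ = resp -1x≈-x (*ₗ-closed (A.- A.1#) x∈)
    where
    module A = CommutativeRing A
    open import Algebra.Module.Properties M using (inverseˡ-uniqueᴹ)
    open import Relation.Binary.Reasoning.Setoid ≈ᴹ-setoid
    -1x≈-x : (A.- A.1#) *ₗ x ≈ᴹ -ᴹ x
    -1x≈-x = inverseˡ-uniqueᴹ _ x (begin
      (A.- A.1#) *ₗ x +ᴹ x            ≈⟨ +ᴹ-congˡ (*ₗ-identityˡ x) ⟨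
      (A.- A.1#) *ₗ x +ᴹ A.1# *ₗ x    ≈⟨ *ₗ-distribʳ x _ _ ⟨
      ((A.- A.1#) A.+ A.1#) *ₗ x      ≈⟨ *ₗ-cong (A.-‿inverseˡ A.1#) ≈ᴹ-refl ⟩
      A.0# *ₗ x                       ≈⟨ *ₗ-zeroˡ x ⟩
      0ᴹ                              ∎)

open Submodule public using (Member)

submodule : ∀ {r ℓr m ℓm p} {A : CommutativeRing r ℓr} {M : Module A m ℓm} →
            Submodule M p → Module A (m ⊔ p) ℓm
submodule {A = A} {M = M} N = record
  { Carrierᴹ = ∃ N.Member
  ; _≈ᴹ_     = λ x y → proj₁ x ≈ᴹ proj₁ y
  ; _+ᴹ_     = λ (x , x∈) (y , y∈) → x +ᴹ y , N.+-closed x∈ y∈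
  ; _*ₗ_     = λ a (x , x∈) → a *ₗ x , N.*ₗ-closed a x∈
  ; _*ᵣ_     = λ (x , x∈) a → a *ₗ x , N.*ₗ-closed a x∈
  ; 0ᴹ       = 0ᴹ , N.0-closed
  ; -ᴹ_      = λ (x , x∈) → -ᴹ x , N.-ᴹ-closed x∈
  ; isModule = IsModuleFromLeft.isModule {commutativeRing = A} record
    { isLeftModule = record
      { isLeftSemimodule = record
        { +ᴹ-isCommutativeMonoid = record
          { isMonoid = record
            { isSemigroup = record
              { isMagma = record
                { isEquivalence = record { refl = ≈ᴹ-refl ; sym = ≈ᴹ-sym ; trans = ≈ᴹ-trans }
                ; ∙-cong        = +ᴹ-cong
                }
              ; assoc = λ _ _ _ → +ᴹ-assoc _ _ _
              }
            ; identity = (λ _ → +ᴹ-identityˡ _) , (λ _ → +ᴹ-identityʳ _)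
            }
          ; comm = λ _ _ → +ᴹ-comm _ _
          }
        ; isPreleftSemimodule = record
          { *ₗ-cong      = *ₗ-cong
          ; *ₗ-zeroˡ     = λ _ → *ₗ-zeroˡ _
          ; *ₗ-distribʳ  = λ _ → *ₗ-distribʳ _
          ; *ₗ-identityˡ = λ _ → *ₗ-identityˡ _
          ; *ₗ-assoc     = λ _ _ _ → *ₗ-assoc _ _ _
          ; *ₗ-zeroʳ     = *ₗ-zeroʳ
          ; *ₗ-distribˡ  = λ _ _ _ → *ₗ-distribˡ _ _ _
          }
        }
      ; -ᴹ‿cong    = -ᴹ‿cong
      ; -ᴹ‿inverse = (λ _ → -ᴹ‿inverseˡ _) , (λ _ → -ᴹ‿inverseʳ _)
      }
    }
  }
  where
  module N = Submodule N
  open Module M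

Ideal : ∀ {c ℓ} (A : CommutativeRing c ℓ) p → Set (c ⊔ ℓ ⊔ lsuc p)
Ideal A p = Submodule (⟨module⟩ {R = A}) p

SameIdeal : ∀ {c ℓ p} {A : CommutativeRing c ℓ} → Rel (Ideal A p) (c ⊔ p)
SameIdeal I J = Member I ≐ Member J

module _ {c ℓ} (A : CommutativeRing c ℓ) where

  open CommutativeRing A using (Carrier; _≈_; _+_; _*_; 0#)

  data Generated {p} (G : Pred Carrier p) : Pred Carrier (c ⊔ ℓ ⊔ p) where
    gen  : ∀ {x} → G x → Generated G x
    cong : ∀ {x y} → x ≈ y → Generated G x → Generated G y
    zero : Generated G 0#
    add  : ∀ {x y} → Generated G x → Generated G y → Generated G (x + y)
    mul  : ∀ a {x} → Generated G x → Generated G (a * x)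

  idealGeneratedBy : ∀ {p} → Pred Carrier p → Ideal A (c ⊔ ℓ ⊔ p)
  idealGeneratedBy G = record
    { Member    = Generated G
    ; resp      = cong
    ; 0-closed  = zero
    ; +-closed  = add
    ; *ₗ-closed = mul
    }

  data Products {p q} (I : Ideal A p) (J : Ideal A q) : Pred Carrier (c ⊔ p ⊔ q) where
    product : ∀ {a b} → Member I a → Member J b → Products I J (a * b)

  idealProduct : ∀ {p q} → Ideal A p → Ideal A q → Ideal A (c ⊔ ℓ ⊔ p ⊔ q)
  idealProduct I J = idealGeneratedBy (Products I J)

  unitIdeal : ∀ {p} → Ideal A p
  unitIdeal = record
    { Member    = λ _ → Lift _ ⊤
    ; resp      = λ _ _ → lift tt
    ; 0-closed  = lift tt
    ; +-closed  = λ _ _ → lift tt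
    ; *ₗ-closed = λ _ _ → lift tt
    }

  idealPower : Ideal A (c ⊔ ℓ) → ℕ → Ideal A (c ⊔ ℓ)
  idealPower I zero    = unitIdeal
  idealPower I (suc d) = idealProduct I (idealPower I d)

module Differences {c ℓ} (A : CommutativeRing c ℓ) where

  open CommutativeRing A
  open RingProperties ring using (x[y-z]≈xy-xz)
  open AbelianGroupProperties +-abelianGroup using (⁻¹-∙-comm; ⁻¹-anti-homo-//; //-rightDividesˡ)
  open CommutativeSemigroupProperties +-commutativeSemigroup using (interchange)
  open import Relation.Binary.Reasoning.Setoid setoid

  +-difference : ∀ x y u v → (x - y) + (u - v) ≈ (x + u) - (y + v)
  +-difference x y u v = begin
    (x - y) + (u - v)          ≈⟨ interchange x (- y) u (- v) ⟩
    (x + u) + (- y + - v)      ≈⟨ +-congˡ (⁻¹-∙-comm y v) ⟩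
    (x + u) - (y + v)          ∎

  *-difference : ∀ a x y → a * (x - y) ≈ a * x - a * y
  *-difference = x[y-z]≈xy-xz

  swap-difference : ∀ x y → - (x - y) ≈ y - x
  swap-difference = ⁻¹-anti-homo-//

  trans-difference : ∀ x y z → (x - y) + (y - z) ≈ x - z
  trans-difference x y z = begin
    (x - y) + (y - z)  ≈⟨ +-assoc (x - y) y (- z) ⟨
    (x - y) + y - z    ≈⟨ +-congʳ (//-rightDividesˡ y x) ⟩
    x - z              ∎

  neg-difference : ∀ x y → - (x - y) ≈ (- x) - (- y)
  neg-difference x y = sym (⁻¹-∙-comm x (- y))

  mixed-difference : ∀ x y u v → u * (x - y) + y * (u - v) ≈ x * u - y * v
  mixed-difference x y u v = begin
    u * (x - y) + y * (u - v)              ≈⟨ +-cong (x[y-z]≈xy-xz u x y) (x[y-z]≈xy-xz y u v) ⟩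
    (u * x - u * y) + (y * u - y * v)      ≈⟨ +-cong (+-cong (*-comm u x) (-‿cong (*-comm u y))) refl ⟩
    (x * u - y * u) + (y * u - y * v)      ≈⟨ trans-difference (x * u) (y * u) (y * v) ⟩
    x * u - y * v                          ∎

  0-difference : ∀ {x y} → x ≈ y → 0# ≈ x - y
  0-difference {x} {y} e = begin
    0#     ≈⟨ -‿inverseʳ y ⟨
    y - y  ≈⟨ +-congʳ e ⟨
    x - y  ∎

module Quotient {c ℓ p} (A : CommutativeRing c ℓ) (I : Ideal A p) where

  open CommutativeRing A
  open Differences A
  private module I = Submodule I

  record _≡ᴵ_ (x y : Carrier) : Set p where
    constructor congruent
    field difference : Member I (x - y)

  ≈⇒≡ᴵ : ∀ {x y} → x ≈ y → x ≡ᴵ y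
  ≈⇒≡ᴵ e = congruent (I.resp (0-difference e) I.0-closed)

  commutativeRing : CommutativeRing c p
  commutativeRing = record
    { Carrier = Carrier
    ; _≈_ = _≡ᴵ_
    ; _+_ = _+_
    ; _*_ = _*_
    ; -_  = λ x → - x
    ; 0#  = 0#
    ; 1#  = 1#
    ; isCommutativeRing = record
      { isRing = record
        { +-isAbelianGroup = record
          { isGroup = record
            { isMonoid = record
              { isSemigroup = record
                { isMagma = record
                  { isEquivalence = record
                    { refl  = ≈⇒≡ᴵ refl
                    ; sym   = λ (congruent i) → congruent (I.resp (swap-difference _ _) (I.-ᴹ-closed i))
                    ; trans = λ (congruent i) (congruent j) → congruent (I.resp (trans-difference _ _ _) (I.+-closed i j))
                    }
                  ; ∙-cong = λ (congruent i) (congruent j) → congruent (I.resp (+-difference _ _ _ _) (I.+-closed i j))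
                  }
                ; assoc = λ x y z → ≈⇒≡ᴵ (+-assoc x y z)
                }
              ; identity = (λ x → ≈⇒≡ᴵ (+-identityˡ x)) , λ x → ≈⇒≡ᴵ (+-identityʳ x)
              }
            ; inverse = (λ x → ≈⇒≡ᴵ (-‿inverseˡ x)) , λ x → ≈⇒≡ᴵ (-‿inverseʳ x)
            ; ⁻¹-cong = λ (congruent i) → congruent (I.resp (neg-difference _ _) (I.-ᴹ-closed i))
            }
          ; comm = λ x y → ≈⇒≡ᴵ (+-comm x y)
          }
        ; *-cong = λ {x} {y} {u} {v} (congruent i) (congruent j) →
            congruent (I.resp (mixed-difference x y u v) (I.+-closed (I.*ₗ-closed u i) (I.*ₗ-closed y j)))
        ; *-assoc    = λ x y z → ≈⇒≡ᴵ (*-assoc x y z)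
        ; *-identity = (λ x → ≈⇒≡ᴵ (*-identityˡ x)) , λ x → ≈⇒≡ᴵ (*-identityʳ x)
        ; distrib    = (λ x y z → ≈⇒≡ᴵ (distribˡ x y z)) , λ x y z → ≈⇒≡ᴵ (distribʳ x y z)
        }
      ; *-comm = λ x y → ≈⇒≡ᴵ (*-comm x y)
      }
    }

  projection : RingHomomorphism rawRing (CommutativeRing.rawRing commutativeRing)
  projection = record
    { ⟦_⟧ = λ x → x
    ; isRingHomomorphism = record
      { isSemiringHomomorphism = record
        { isNearSemiringHomomorphism = record
          { +-isMonoidHomomorphism = record
            { isMagmaHomomorphism = record
              { isRelHomomorphism = record { cong = ≈⇒≡ᴵ }
              ; homo              = λ _ _ → ≈⇒≡ᴵ refl
              }
            ; ε-homo = ≈⇒≡ᴵ refl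
            }
          ; *-homo = λ _ _ → ≈⇒≡ᴵ refl
          }
        ; 1#-homo = ≈⇒≡ᴵ refl
        }
      ; -‿homo = λ _ → ≈⇒≡ᴵ refl
      }
    }

restrictScalars : ∀ {a ℓa b ℓb m ℓm} {A : CommutativeRing a ℓa} {B : CommutativeRing b ℓb} →
                  RingHomomorphism (CommutativeRing.rawRing A) (CommutativeRing.rawRing B) →
                  Module B m ℓm → Module A m ℓm
restrictScalars {A = A} f M = record
  { Carrierᴹ = Carrierᴹ
  ; _≈ᴹ_     = _≈ᴹ_
  ; _+ᴹ_     = _+ᴹ_
  ; _*ₗ_     = λ a x → ⟦ a ⟧ *ₗ x
  ; _*ᵣ_     = λ x a → ⟦ a ⟧ *ₗ x
  ; 0ᴹ       = 0ᴹ
  ; -ᴹ_      = λ x → -ᴹ x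
  ; isModule = IsModuleFromLeft.isModule {commutativeRing = A} record
    { isLeftModule = record
      { isLeftSemimodule = record
        { +ᴹ-isCommutativeMonoid = +ᴹ-isCommutativeMonoid
        ; isPreleftSemimodule = record
          { *ₗ-cong      = λ e → *ₗ-cong (⟦⟧-cong e)
          ; *ₗ-zeroˡ     = λ x → ≈ᴹ-trans (*ₗ-cong 0#-homo ≈ᴹ-refl) (*ₗ-zeroˡ x)
          ; *ₗ-distribʳ  = λ x a b → ≈ᴹ-trans (*ₗ-cong (+-homo a b) ≈ᴹ-refl) (*ₗ-distribʳ x _ _)
          ; *ₗ-identityˡ = λ x → ≈ᴹ-trans (*ₗ-cong 1#-homo ≈ᴹ-refl) (*ₗ-identityˡ x)
          ; *ₗ-assoc     = λ a b x → ≈ᴹ-trans (*ₗ-cong (*-homo a b) ≈ᴹ-refl) (*ₗ-assoc _ _ x)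
          ; *ₗ-zeroʳ     = λ a → *ₗ-zeroʳ ⟦ a ⟧
          ; *ₗ-distribˡ  = λ a → *ₗ-distribˡ ⟦ a ⟧
          }
        }
      ; -ᴹ‿cong    = -ᴹ‿cong
      ; -ᴹ‿inverse = -ᴹ‿inverse
      }
    }
  }
  where
  open RingHomomorphism f
  open Module M

-- For a finite V this is the direct sum of copies of A indexed by V.

functionModule : ∀ {c ℓ v} (A : CommutativeRing c ℓ) → Set v → Module A (c ⊔ v) (ℓ ⊔ v)
functionModule A V = record
  { Carrierᴹ = V → Carrier
  ; _≈ᴹ_     = λ f g → ∀ v → f v ≈ g v
  ; _+ᴹ_     = λ f g v → f v + g v
  ; _*ₗ_     = λ a f v → a * f v
  ; _*ᵣ_     = λ f a v → a * f v
  ; 0ᴹ       = λ _ → 0#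
  ; -ᴹ_      = λ f v → - f v
  ; isModule = IsModuleFromLeft.isModule {commutativeRing = A} record
    { isLeftModule = record
      { isLeftSemimodule = record
        { +ᴹ-isCommutativeMonoid = record
          { isMonoid = record
            { isSemigroup = record
              { isMagma = record
                { isEquivalence = record
                  { refl  = λ _ → refl
                  ; sym   = λ e v → sym (e v)
                  ; trans = λ e e′ v → trans (e v) (e′ v)
                  }
                ; ∙-cong = λ e e′ v → +-cong (e v) (e′ v)
                }
              ; assoc = λ _ _ _ _ → +-assoc _ _ _
              }
            ; identity = (λ _ _ → +-identityˡ _) , λ _ _ → +-identityʳ _
            }
          ; comm = λ _ _ _ → +-comm _ _
          }
        ; isPreleftSemimodule = record
          { *ₗ-cong      = λ e e′ v → *-cong e (e′ v)
          ; *ₗ-zeroˡ     = λ _ _ → zeroˡ _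
          ; *ₗ-distribʳ  = λ _ _ _ _ → distribʳ _ _ _
          ; *ₗ-identityˡ = λ _ _ → *-identityˡ _
          ; *ₗ-assoc     = λ _ _ _ _ → *-assoc _ _ _
          ; *ₗ-zeroʳ     = λ _ _ → zeroʳ _
          ; *ₗ-distribˡ  = λ _ _ _ _ → distribˡ _ _ _
          }
        }
      ; -ᴹ‿cong    = λ e v → -‿cong (e v)
      ; -ᴹ‿inverse = (λ _ _ → -‿inverseˡ _) , λ _ _ → -‿inverseʳ _
      }
    }
  }
  where open CommutativeRing A

module _ {c ℓ m ℓm} {K : CommutativeRing c ℓ} (M : Module K m ℓm) where

  open CommutativeRing K using (Carrier; _≈_; 0#)
  open Module M using (Carrierᴹ; _≈ᴹ_; _*ₗ_; 0ᴹ; +ᴹ-rawMonoid)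

  combination : ∀ {n} → (Fin n → Carrier) → (Fin n → Carrierᴹ) → Carrierᴹ
  combination c b = RawMonoidDefs.sum +ᴹ-rawMonoid (λ i → c i *ₗ b i)

  record IsBasis {n} (b : Fin n → Carrierᴹ) : Set (c ⊔ ℓ ⊔ m ⊔ ℓm) where
    field
      independent : ∀ c → combination c b ≈ᴹ 0ᴹ → ∀ i → c i ≈ 0#
      spanning    : ∀ x → ∃ λ c → combination c b ≈ᴹ x

  HasDimension : ℕ → Set (c ⊔ ℓ ⊔ m ⊔ ℓm)
  HasDimension n = Σ (Fin n → Carrierᴹ) IsBasis

data Tree (L : Set) : Set where
  node : List (L × Tree L) → Tree L

data Vertex {L : Set} : Tree L → Set where
  root  : ∀ {bs} → Vertex (node bs)
  below : ∀ {bs} (i : Fin (length bs)) → Vertex (proj₂ (lookup bs i)) → Vertex (node bs)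

-- stem i is the edge from the root to its i-th child.

data Edge {L : Set} : Tree L → Set where
  stem  : ∀ {bs} → Fin (length bs) → Edge (node bs)
  below : ∀ {bs} (i : Fin (length bs)) → Edge (proj₂ (lookup bs i)) → Edge (node bs)

rootOf : ∀ {L} (t : Tree L) → Vertex t
rootOf (node _) = root

upper lower : ∀ {L} {t : Tree L} → Edge t → Vertex t
upper (stem i)    = root
upper (below i e) = below i (upper e)
lower (stem i)    = below i (rootOf _)
lower (below i e) = below i (lower e)

label : ∀ {L} {t : Tree L} → Edge t → L
label (stem {bs} i) = proj₁ (lookup bs i)
label (below i e)   = label e

edgeCount  : ∀ {L} → Tree L → ℕ
edgeCounts : ∀ {L} → List (L × Tree L) → ℕ
edgeCount (node bs) = edgeCounts bs
edgeCounts []             = 0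
edgeCounts ((_ , t) ∷ bs) = suc (edgeCount t) +ℕ edgeCounts bs

module _ {c ℓ p} (A : CommutativeRing c ℓ) {L : Set} (α : L → Ideal A p) (t : Tree L) where

  open CommutativeRing A
  open Differences A

  splines : Submodule (functionModule A (Vertex t)) p
  splines = record
    { Member    = λ f → ∀ e → Member (α (label e)) (f (upper e) - f (lower e))
    ; resp      = λ f≈g f∈ e → resp (α (label e)) (+-cong (f≈g _) (-‿cong (f≈g _))) (f∈ e)
    ; 0-closed  = λ e → resp (α (label e)) (0-difference refl) (0-closed (α (label e)))
    ; +-closed  = λ f∈ g∈ e → resp (α (label e)) (+-difference _ _ _ _) (+-closed (α (label e)) (f∈ e) (g∈ e))
    ; *ₗ-closed = λ a f∈ e → resp (α (label e)) (*-difference a _ _) (*ₗ-closed (α (label e)) a (f∈ e))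
    }
    where open Submodule

  Spl : Module A (c ⊔ p) ℓ
  Spl = submodule splines

data Paren (L : Set) : Set where
  ⦅ ⦆ : L → Paren L

data Dyck {L : Set} : List (Paren L) → Set where
  ε    : Dyck []
  wrap : ∀ α {u v} → Dyck u → Dyck v → Dyck (⦅ α ∷ u ++ ⦆ α ∷ v)

DyckWord : Set → Set
DyckWord L = ∃ (Dyck {L})

branches : ∀ {L} {w : List (Paren L)} → Dyck w → List (L × Tree L)
branches ε            = []
branches (wrap α p q) = (α , node (branches p)) ∷ branches q

treeOf : ∀ {L} → DyckWord L → Tree L
treeOf (_ , p) = node (branches p)

size : ∀ {L} → DyckWord L → ℕ
size w = edgeCount (treeOf w)

parenthesise : ∀ {L} → L → DyckWord L → DyckWord L → DyckWord L
parenthesise α (_ , p) (_ , q) = _ , wrap α p q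

-- The words with m pairs of parentheses, by their first return:
-- each nonempty word is uniquely (α u )α v with u and v Dyck words.
-- The fuel f only needs m ≤ f.

dyckWordsFuelled : ∀ s (f m : ℕ) → List (DyckWord (Fin s))
dyckWordsFuelled s f       zero    = ([] , ε) ∷ []
dyckWordsFuelled s zero    (suc m) = []
dyckWordsFuelled s (suc f) (suc m) =
  concatMap (λ α → concatMap (λ i →
    cartesianProductWith (parenthesise α) (dyckWordsFuelled s f i) (dyckWordsFuelled s f (m ∸ i)))
  (upTo (suc m))) (allFin s)

dyckWords : ∀ s (m : ℕ) → List (DyckWord (Fin s))
dyckWords s m = dyckWordsFuelled s m m

private
  prefix-unique : ∀ {L : Set} {u u′ v v′ : List (Paren L)} {α β} → Dyck u → Dyck u′ →
                  u ++ ⦆ α ∷ v ≡ u′ ++ ⦆ β ∷ v′ → u ≡ u′ × α ≡ β × v ≡ v′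
  prefix-unique ε ε ≡.refl = ≡.refl , ≡.refl , ≡.refl
  prefix-unique ε (wrap _ _ _) ()
  prefix-unique (wrap _ _ _) ε ()
  prefix-unique {v = v} {v′} {α} {β} (wrap γ {a} {b} p q) (wrap δ {a′} {b′} p′ q′) e
    with ∷-injectiveˡ e | prefix-unique p p′ (≡.trans (≡.sym (++-assoc a _ _)) (≡.trans (∷-injectiveʳ e) (++-assoc a′ _ _)))
  ... | ≡.refl | ≡.refl , ≡.refl , e′ with prefix-unique q q′ e′
  ... | ≡.refl , e″ = ≡.refl , e″

  parenthesise-inverse : ∀ {L : Set} {α β} {u u′ v v′ : List (Paren L)} → Dyck u → Dyck u′ →
                         ⦅ α ∷ u ++ ⦆ α ∷ v ≡ ⦅ β ∷ u′ ++ ⦆ β ∷ v′ → α ≡ β × u ≡ u′ × v ≡ v′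
  parenthesise-inverse p p′ e with prefix-unique p p′ (∷-injectiveʳ e)
  ... | u≡u′ , α≡β , v≡v′ = α≡β , u≡u′ , v≡v′

  derivation-unique : ∀ {L : Set} {w w′ : List (Paren L)} (p : Dyck w) (p′ : Dyck w′) →
                      w ≡ w′ → _≡_ {A = DyckWord L} (w , p) (w′ , p′)
  derivation-unique ε ε _ = ≡.refl
  derivation-unique ε (wrap _ _ _) ()
  derivation-unique (wrap _ _ _) ε ()
  derivation-unique (wrap α p q) (wrap β p′ q′) e with parenthesise-inverse p p′ e
  ... | ≡.refl , u≡u′ , v≡v′ =
    ≡.cong₂ (parenthesise α) (derivation-unique p p′ u≡u′) (derivation-unique q q′ v≡v′)

-- A Dyck word is determined by its underlying word, so DyckWord L is the
-- set of words in the Dyck language.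

dyckWord-≡ : ∀ {L} {w w′ : DyckWord L} → proj₁ w ≡ proj₁ w′ → w ≡ w′
dyckWord-≡ {w = _ , p} {_ , p′} = derivation-unique p p′

private
  parenthesise-injective : ∀ {L} {α β : L} {u u′ v v′} → parenthesise α u v ≡ parenthesise β u′ v′ →
                           α ≡ β × u ≡ u′ × v ≡ v′
  parenthesise-injective {u = _ , p} {_ , p′} e with parenthesise-inverse p p′ (≡.cong proj₁ e)
  ... | α≡β , e₁ , e₂ = α≡β , dyckWord-≡ e₁ , dyckWord-≡ e₂

  complete : ∀ {s f} {w : List (Paren (Fin s))} (p : Dyck w) → size (w , p) ≤ f →
             (w , p) ∈ dyckWordsFuelled s f (size (w , p))
  complete {f = zero}  ε _ = here ≡.refl
  complete {f = suc f} ε _ = here ≡.refl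
  complete {s} {suc f} (wrap α {u} {v} p q) (s≤s le) =
    ∈-concatMap⁺ _ (lose (∈-allFin α) (∈-concatMap⁺ _ (lose (∈-upTo⁺ (s≤s (m≤m+n i j)))
      (∈-cartesianProductWith⁺ (parenthesise α)
        (complete p (≤-trans (m≤m+n i j) le))
        (≡.subst (λ n → (v , q) ∈ dyckWordsFuelled s f n) (≡.sym (m+n∸m≡n i j))
          (complete q (≤-trans (m≤n+m j i) le)))))))
    where
    i = size (u , p)
    j = size (v , q)

  sound : ∀ {s} f m {w} → w ∈ dyckWordsFuelled s f m → size w ≡ m
  sound zero    zero    (here ≡.refl) = ≡.refl
  sound (suc f) zero    (here ≡.refl) = ≡.refl
  sound {s} (suc f) (suc m) w∈
    with α , _ , w∈′ ← find (∈-concatMap⁻ _ {xs = allFin s} w∈)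
    with i , i∈ , w∈″ ← find (∈-concatMap⁻ _ {xs = upTo (suc m)} w∈′)
    with (u , p) , (v , q) , u∈ , v∈ , ≡.refl ← ∈-cartesianProductWith⁻ (parenthesise α) (dyckWordsFuelled s f i) _ w∈″
    = ≡.cong suc (≡.trans (≡.cong₂ _+ℕ_ (sound f i u∈) (sound f (m ∸ i) v∈)) (m+[n∸m]≡n (s≤s⁻¹ (∈-upTo⁻ i∈))))

  concatMap-unique : ∀ {A B : Set} (f : A → List B) {xs} → Unique xs → (∀ x → Unique (f x)) →
                     (∀ {x y z} → z ∈ f x → z ∈ f y → x ≡ y) → Unique (concatMap f xs)
  concatMap-unique f xs! f! disjoint = Uniqueₚ.concat⁺ (Allₚ.map⁺ (All.universal f! _))
    (AllPairsₚ.map⁺ (AllPairs.map (λ { x≢y {z} (z∈fx , z∈fy) → x≢y (disjoint z∈fx z∈fy) }) xs!))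

  unique : ∀ s f m → Unique (dyckWordsFuelled s f m)
  unique s f       zero    = All.[] AllPairs.∷ AllPairs.[]
  unique s zero    (suc m) = AllPairs.[]
  unique s (suc f) (suc m) = concatMap-unique _ (Uniqueₚ.allFin⁺ s)
    (λ α → concatMap-unique _ (Uniqueₚ.upTo⁺ (suc m))
      (λ i → Uniqueₚ.cartesianProductWith⁺ _ (λ e → proj₂ (parenthesise-injective e)) (unique s f i) (unique s f (m ∸ i)))
      λ {i} {j} → first-size α {i} {j})
    λ {α} {β} → first-label {α} {β}
    where
    block : Fin s → ℕ → List (DyckWord (Fin s))
    block α i = cartesianProductWith (parenthesise α) (dyckWordsFuelled s f i) (dyckWordsFuelled s f (m ∸ i))

    first-size : ∀ α {i j w} → w ∈ block α i → w ∈ block α j → i ≡ j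
    first-size α {i} {j} w∈ w∈′
      with _ , _ , u∈ , _ , e  ← ∈-cartesianProductWith⁻ (parenthesise α) (dyckWordsFuelled s f i) _ w∈
      with _ , _ , u∈′ , _ , e′ ← ∈-cartesianProductWith⁻ (parenthesise α) (dyckWordsFuelled s f j) _ w∈′
      with _ , ≡.refl , _ ← parenthesise-injective (≡.trans (≡.sym e) e′)
      = ≡.trans (≡.sym (sound f i u∈)) (sound f j u∈′)

    first-label : ∀ {α β w} → w ∈ concatMap (block α) (upTo (suc m)) → w ∈ concatMap (block β) (upTo (suc m)) → α ≡ β
    first-label {α} {β} w∈ w∈′
      with i , _ , w∈₁ ← find (∈-concatMap⁻ _ {xs = upTo (suc m)} w∈)
      with j , _ , w∈₂ ← find (∈-concatMap⁻ _ {xs = upTo (suc m)} w∈′)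
      with _ , _ , _ , _ , e  ← ∈-cartesianProductWith⁻ (parenthesise α) (dyckWordsFuelled s f i) _ w∈₁
      with _ , _ , _ , _ , e′ ← ∈-cartesianProductWith⁻ (parenthesise β) (dyckWordsFuelled s f j) _ w∈₂
      = proj₁ (parenthesise-injective (≡.trans (≡.sym e) e′))

dyckWords-complete : ∀ {s} (w : DyckWord (Fin s)) → w ∈ dyckWords s (size w)
dyckWords-complete (_ , p) = complete p ≤-refl

dyckWords-sound : ∀ {s m w} → w ∈ dyckWords s m → size w ≡ m
dyckWords-sound {m = m} = sound m m

dyckWords-unique : ∀ s m → Unique (dyckWords s m)
dyckWords-unique s m = unique s m m

PowerSeries : Set
PowerSeries = ℕ → ℚ

ℚ[t] ℚ[t][x] : CommutativeRing 0ℓ 0ℓ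
ℚ[t]    = Poly.commutativeRing ℚₚ.+-*-commutativeRing
ℚ[t][x] = Poly.commutativeRing ℚ[t]

_⊕_ _⊛_ : PowerSeries → PowerSeries → PowerSeries
(F ⊕ G) m = F m ℚ.+ G m
(F ⊛ G) m = RawMonoidDefs.sum ℚ.+-0-rawMonoid λ (i : Fin (suc m)) → F (toℕ i) ℚ.* G (m ∸ toℕ i)

-- An element of ℚ[t][x] is P(x,t); this is P(F(t),t) by Horner's rule.

evaluate : CommutativeRing.Carrier ℚ[t][x] → PowerSeries → PowerSeries
evaluate []      F = λ _ → ℚ.0ℚ
evaluate (a ∷ P) F = Poly.coeff ℚₚ.+-*-commutativeRing a ⊕ (F ⊛ evaluate P F)

Algebraic : PowerSeries → Set
Algebraic F = ∃ λ P → ¬ (P ≈ 0#) × (∀ m → evaluate P F m ≡ ℚ.0ℚ)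
  where open CommutativeRing ℚ[t][x]

-- Classically a HeytingField is an ordinary field, with _#_ the relation _≉_;
-- 1 ≉ 0 follows from irreflexivity of _#_.

module _ {c ℓ₁ ℓ₂} (k : HeytingField c ℓ₁ ℓ₂) (n d : ℕ) where

  scalars : CommutativeRing c ℓ₁
  scalars = HeytingCommutativeRing.commutativeRing (HeytingField.heytingCommutativeRing k)

  open MultiPoly scalars using (polynomials; constants; variables)

  maximalIdeal : Ideal (polynomials n) (c ⊔ ℓ₁)
  maximalIdeal = idealGeneratedBy (polynomials n) λ f → ∃ λ i → f ≡ variables n i

  truncatedPolynomials : CommutativeRing c (c ⊔ ℓ₁)
  truncatedPolynomials = Quotient.commutativeRing (polynomials n) (idealPower (polynomials n) maximalIdeal d)

  structureMap : RingHomomorphism (CommutativeRing.rawRing scalars) (CommutativeRing.rawRing truncatedPolynomials)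
  structureMap = Composition.ringHomomorphism
    {M₁ = CommutativeRing.ring scalars} {CommutativeRing.ring (polynomials n)} {CommutativeRing.ring truncatedPolynomials}
    (constants n) (Quotient.projection (polynomials n) (idealPower (polynomials n) maximalIdeal d))

  SplineDimension : ∀ {p s} → (Fin s → Ideal truncatedPolynomials p) → (DyckWord (Fin s) → ℕ) → Set (c ⊔ ℓ₁ ⊔ p)
  SplineDimension S dim = ∀ w →
    HasDimension (restrictScalars {A = scalars} structureMap (Spl truncatedPolynomials S (treeOf w))) (dim w)

hilbertDyckSeries : ∀ {s} → (DyckWord (Fin s) → ℕ) → PowerSeries
hilbertDyckSeries {s} dim m = + sum (map dim (dyckWords s m)) / 1

-- Fixing the value at the root and the difference along each edge identifies Spl_R(T), over k, with R plus
-- the direct sum of the ideals α(e). Hence dim Spl_R(T(w)) = D + Σ_e a(e), where D = dim R and a(e) = dim α(e).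
-- Let G count Dyck words and let H sum Σ_e a(e) over them, so that HD = D G + H. With s = |S| and A = Σ_{α ∈ S} dim α,
-- the first-return decomposition gives G = 1 + s t G² and H = t (A G² + 2 s G H). Since (1 - 2 s t G)² = 1 - 4 s t = Δ,
-- eliminating G and H shows that, for K = s D - A, the series x = HD satisfies
--   s² t Δ x² - Δ K x + Δ D K - t A² = 0.
-- When s = 0 this equation is vacuous, but then HD = D.
-- Membership in the ideals and equality in k are undecidable, so bases exist only up to double negation; the dimensions
-- are natural numbers, so equations between them still hold outright.

module Submission where

open import Defs
open import Algebra.Apartness.Bundles using (HeytingField; HeytingCommutativeRing)
import Algebra.Apartness.Properties.HeytingCommutativeRing as HeytingProperties
open import Algebra.Bundles using (CommutativeMonoid; CommutativeRing)
import Algebra.Definitions.RawMonoid as RawMonoidDefs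
open import Algebra.Module.Bundles using (Module)
open import Algebra.Module.Construct.TensorUnit using (⟨module⟩)
open import Algebra.Morphism.Bundles using (RingHomomorphism)
import Algebra.Properties.AbelianGroup as AbelianGroupProperties
import Algebra.Properties.CommutativeMonoid.Sum as MonoidSum
import Algebra.Properties.CommutativeSemigroup as CommutativeSemigroupProperties
import Algebra.Properties.Group as GroupProperties
import Algebra.Properties.Ring as RingProperties
import Algebra.Solver.Ring
open import Algebra.Solver.Ring.AlmostCommutativeRing using (fromCommutativeRing; _-Raw-AlmostCommutative⟶_)
open import Data.Fin.Base using (Fin; zero; suc; toℕ; _↑ˡ_; _↑ʳ_; punchIn; splitAt)
open import Data.Fin.Patterns using (0F)
import Data.Fin.Properties as Finₚ
open import Data.Integer.Base as ℤ using (ℤ; +_)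
import Data.Integer.Properties as ℤₚ
open import Data.List.Base using (List; []; _∷_; concat; map; concatMap; cartesianProductWith; upTo; applyUpTo; allFin; tabulate)
  renaming (_++_ to _++ₗ_)
open import Data.List.Membership.Propositional.Properties using (∈-upTo⁻)
open import Data.List.Properties using (map-cong; map-cong-local)
import Data.List.Relation.Unary.All as All
open import Data.Maybe.Base using (Maybe; just; nothing)
open import Data.Nat.Base as ℕ using (ℕ; zero; suc; NonZero; _∸_; _≤_; z≤n; s≤s; s≤s⁻¹)
open import Data.Nat.ListAction using () renaming (sum to sumℕ)
import Data.Nat.Properties as ℕₚ
open import Data.Product.Base using (∃; ∃₂; _×_; _,_; proj₁; proj₂)
open import Data.Rational.Base as ℚ using (ℚ; _/_; toℚᵘ)
import Data.Rational.Properties as ℚₚ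
import Data.Rational.Unnormalised.Base as ℚᵘ
import Data.Rational.Unnormalised.Properties as ℚᵘₚ
open import Data.Sum.Base using (inj₁; inj₂)
open import Data.Unit.Base using (⊤; tt)
open import Data.Vec.Functional using (Vector; _++_; removeAt; insertAt)
open import Data.Vec.Functional.Properties using (insertAt-lookup; insertAt-punchIn; lookup-++ˡ; lookup-++ʳ)
open import Effect.Monad using (module RawMonad)
open import Function.Base using (_∘_)
open import Function.Definitions using (Injective)
open import Level using (_⊔_; lift)
open import Relation.Binary.PropositionalEquality as ≡ using (_≡_)
open import Relation.Nullary.Decidable.Core using (Dec; yes; no; ¬¬-excluded-middle; decidable-stable)
open import Relation.Nullary.Negation using (¬_; contradiction; ¬¬-map; ¬¬-Monad)
open import Relation.Unary using (Pred)

-- Formal power series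

-- `Algebraic` asks for an actual polynomial, and constructively double negation commutes with
-- quantification over a finite set but not, in general, over all Dyck words. So only s + 1
-- dimensions, those of R and of the s ideals, are obtained under double negation; explicit bases
-- for all trees follow from them by induction. The coefficients of the polynomial come from the
-- given function `dim` itself: D is its value at the empty word, and a(α) is the excess over D of
-- its value at the one-edge tree labelled α. The hidden bases serve only to prove the numerical
-- equation between `dim` and these values. An edge can be split off because subtracting the root
-- value from the values on a branch leaves a spline on that branch whose own root value lies in the
-- label of the joining edge. The induction therefore runs over splines with root value in a
-- prescribed ideal.

module FormalSeries {c ℓ} (A : CommutativeRing c ℓ) where

  open CommutativeRing A
  open CommutativeSemigroupProperties +-commutativeSemigroup using (interchange; x∙yz≈y∙xz)
  open import Relation.Binary.Reasoning.Setoid setoid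

  Series : Set c
  Series = ℕ → Carrier

  infix 4 _≋_
  _≋_ : Series → Series → Set ℓ
  F ≋ G = ∀ m → F m ≈ G m

  infixl 6 _+ˢ_
  infixl 7 _*ˢ_ _·_
  -- Over the rationals these unfold to `_⊕_` and `_⊛_`, so that `evaluate` is ring arithmetic
  -- without any conversion.
  _+ˢ_ _*ˢ_ : Series → Series → Series
  (F +ˢ G) m = F m + G m
  (F *ˢ G) m = RawMonoidDefs.sum +-rawMonoid λ (i : Fin (suc m)) → F (toℕ i) * G (m ∸ toℕ i)

  _·_ : Carrier → Series → Series
  (a · F) m = a * F m

  0ˢ : Series
  0ˢ _ = 0#

  -ˢ_ : Series → Series
  (-ˢ F) m = - F m

  constantˢ : Carrier → Series
  constantˢ a zero    = a
  constantˢ a (suc _) = 0#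

  shift : Series → Series
  shift F zero    = 0#
  shift F (suc m) = F m

  *ˢ-cong : ∀ {F F′ G G′} → F ≋ F′ → G ≋ G′ → F *ˢ G ≋ F′ *ˢ G′
  *ˢ-cong e f zero    = +-congʳ (*-cong (e 0) (f 0))
  *ˢ-cong e f (suc m) = +-cong (*-cong (e 0) (f (suc m))) (*ˢ-cong (e ∘ suc) f m)

  -- The convolution unfolds from the first coefficient of `F`; commutativity also needs it peeled
  -- from the other end.
  *ˢ-last : ∀ F G m → (F *ˢ G) (suc m) ≈ F (suc m) * G 0 + (F *ˢ (G ∘ suc)) m
  *ˢ-last F G zero    = trans (+-congˡ (+-identityʳ _)) (trans (+-comm _ _) (+-congˡ (sym (+-identityʳ _))))
  *ˢ-last F G (suc m) = begin
    F 0 * G (suc (suc m)) + ((F ∘ suc) *ˢ G) (suc m)                            ≈⟨ +-congˡ (*ˢ-last (F ∘ suc) G m) ⟩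
    F 0 * G (suc (suc m)) + (F (suc (suc m)) * G 0 + ((F ∘ suc) *ˢ (G ∘ suc)) m)  ≈⟨ x∙yz≈y∙xz _ _ _ ⟩
    F (suc (suc m)) * G 0 + (F 0 * G (suc (suc m)) + ((F ∘ suc) *ˢ (G ∘ suc)) m)  ∎

  *ˢ-comm : ∀ F G → F *ˢ G ≋ G *ˢ F
  *ˢ-comm F G zero    = +-congʳ (*-comm _ _)
  *ˢ-comm F G (suc m) = begin
    F 0 * G (suc m) + ((F ∘ suc) *ˢ G) m  ≈⟨ +-cong (*-comm _ _) (*ˢ-comm (F ∘ suc) G m) ⟩
    G (suc m) * F 0 + (G *ˢ (F ∘ suc)) m  ≈⟨ *ˢ-last G F m ⟨
    (G *ˢ F) (suc m)                      ∎

  ·-*ˢ : ∀ a F G → (a · F) *ˢ G ≋ a · (F *ˢ G)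
  ·-*ˢ a F G zero    = trans (+-cong (*-assoc _ _ _) (sym (zeroʳ a))) (sym (distribˡ _ _ _))
  ·-*ˢ a F G (suc m) = trans (+-cong (*-assoc _ _ _) (·-*ˢ a (F ∘ suc) G m)) (sym (distribˡ _ _ _))

  *ˢ-distribʳ : ∀ H F G → (F +ˢ G) *ˢ H ≋ F *ˢ H +ˢ G *ˢ H
  *ˢ-distribʳ H F G zero = begin
    (F 0 + G 0) * H 0 + 0#              ≈⟨ +-cong (distribʳ _ _ _) (sym (+-identityʳ 0#)) ⟩
    F 0 * H 0 + G 0 * H 0 + (0# + 0#)   ≈⟨ interchange _ _ _ _ ⟩
    (F *ˢ H) 0 + (G *ˢ H) 0             ∎
  *ˢ-distribʳ H F G (suc m) = begin
    (F 0 + G 0) * H (suc m) + (((F +ˢ G) ∘ suc) *ˢ H) m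
      ≈⟨ +-cong (distribʳ _ _ _) (*ˢ-distribʳ H (F ∘ suc) (G ∘ suc) m) ⟩
    F 0 * H (suc m) + G 0 * H (suc m) + (((F ∘ suc) *ˢ H) m + ((G ∘ suc) *ˢ H) m)
      ≈⟨ interchange _ _ _ _ ⟩
    (F *ˢ H) (suc m) + (G *ˢ H) (suc m)
      ∎

  *ˢ-assoc : ∀ F G H → (F *ˢ G) *ˢ H ≋ F *ˢ (G *ˢ H)
  *ˢ-assoc F G H zero = +-congʳ (begin
    (F 0 * G 0 + 0#) * H 0    ≈⟨ *-congʳ (+-identityʳ _) ⟩
    F 0 * G 0 * H 0           ≈⟨ *-assoc _ _ _ ⟩
    F 0 * (G 0 * H 0)         ≈⟨ *-congˡ (+-identityʳ _) ⟨
    F 0 * (G 0 * H 0 + 0#)    ∎)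
  -- The tail of `F *ˢ G` unfolds to `F 0 · (G ∘ suc) +ˢ (F ∘ suc) *ˢ G`, so distributivity reduces
  -- the claim to `F ∘ suc` at index `m`.
  *ˢ-assoc F G H (suc m) = begin
    (F 0 * G 0 + 0#) * H (suc m) + ((F 0 · (G ∘ suc) +ˢ (F ∘ suc) *ˢ G) *ˢ H) m
      ≈⟨ +-cong (trans (*-congʳ (+-identityʳ _)) (*-assoc _ _ _)) (*ˢ-distribʳ H (F 0 · (G ∘ suc)) ((F ∘ suc) *ˢ G) m) ⟩
    F 0 * (G 0 * H (suc m)) + (((F 0 · (G ∘ suc)) *ˢ H) m + (((F ∘ suc) *ˢ G) *ˢ H) m)
      ≈⟨ +-assoc _ _ _ ⟨
    F 0 * (G 0 * H (suc m)) + ((F 0 · (G ∘ suc)) *ˢ H) m + (((F ∘ suc) *ˢ G) *ˢ H) m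
      ≈⟨ +-cong (+-congˡ (·-*ˢ (F 0) (G ∘ suc) H m)) (*ˢ-assoc (F ∘ suc) G H m) ⟩
    F 0 * (G 0 * H (suc m)) + F 0 * ((G ∘ suc) *ˢ H) m + ((F ∘ suc) *ˢ (G *ˢ H)) m
      ≈⟨ +-congʳ (distribˡ _ _ _) ⟨
    F 0 * (G *ˢ H) (suc m) + ((F ∘ suc) *ˢ (G *ˢ H)) m
      ∎

  0ˢ-*ˢ : ∀ F → 0ˢ *ˢ F ≋ 0ˢ
  0ˢ-*ˢ F zero    = trans (+-identityʳ _) (zeroˡ _)
  0ˢ-*ˢ F (suc m) = trans (+-cong (zeroˡ _) (0ˢ-*ˢ F m)) (+-identityʳ _)

  constantˢ-*ˢ : ∀ a F → constantˢ a *ˢ F ≋ a · F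
  constantˢ-*ˢ a F zero    = +-identityʳ _
  constantˢ-*ˢ a F (suc m) = trans (+-congˡ (0ˢ-*ˢ F m)) (+-identityʳ _)

  *ˢ-identityˡ : ∀ F → constantˢ 1# *ˢ F ≋ F
  *ˢ-identityˡ F m = trans (constantˢ-*ˢ 1# F m) (*-identityˡ _)

  commutativeRing : CommutativeRing c ℓ
  commutativeRing = record
    { Carrier = Series
    ; _≈_ = _≋_
    ; _+_ = _+ˢ_
    ; _*_ = _*ˢ_
    ; -_  = -ˢ_
    ; 0#  = 0ˢ
    ; 1#  = constantˢ 1#
    ; isCommutativeRing = record
      { isRing = record
        { +-isAbelianGroup = record
          { isGroup = record
            { isMonoid = record
              { isSemigroup = record
                { isMagma = record
                  { isEquivalence = record
                    { refl = λ _ → refl ; sym = λ e m → sym (e m) ; trans = λ e f m → trans (e m) (f m) }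
                  ; ∙-cong = λ e f m → +-cong (e m) (f m)
                  }
                ; assoc = λ _ _ _ _ → +-assoc _ _ _
                }
              ; identity = (λ _ _ → +-identityˡ _) , λ _ _ → +-identityʳ _
              }
            ; inverse = (λ _ _ → -‿inverseˡ _) , λ _ _ → -‿inverseʳ _
            ; ⁻¹-cong = λ e m → -‿cong (e m)
            }
          ; comm = λ _ _ _ → +-comm _ _
          }
        ; *-cong     = *ˢ-cong
        ; *-assoc    = *ˢ-assoc
        ; *-identity = *ˢ-identityˡ , λ F m → trans (*ˢ-comm F (constantˢ 1#) m) (*ˢ-identityˡ F m)
        ; distrib    = (λ F G H m → trans (*ˢ-comm F (G +ˢ H) m)
                         (trans (*ˢ-distribʳ F G H m) (+-cong (*ˢ-comm G F m) (*ˢ-comm H F m))))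
                     , *ˢ-distribʳ
        }
      ; *-comm = *ˢ-comm
      }
    }

  open Poly A using (coeff; scale; _*ₚ_; coeff-+; coeff-scale)

  coeff-* : ∀ p q → coeff (p *ₚ q) ≋ coeff p *ˢ coeff q
  coeff-* []      q m       = sym (0ˢ-*ˢ (coeff q) m)
  coeff-* (a ∷ p) q zero    = trans (coeff-+ (scale a q) _ 0) (+-congʳ (coeff-scale a q 0))
  coeff-* (a ∷ p) q (suc m) = trans (coeff-+ (scale a q) _ (suc m)) (+-cong (coeff-scale a q (suc m)) (coeff-* p q m))

  coeff-constant : ∀ a → coeff (Poly.constant A a) ≋ constantˢ a
  coeff-constant a zero    = refl
  coeff-constant a (suc m) = refl

  indeterminate-*ˢ : ∀ F → coeff (Poly.indeterminate A) *ˢ F ≋ shift F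
  indeterminate-*ˢ F zero    = trans (+-identityʳ _) (zeroˡ _)
  indeterminate-*ˢ F (suc m) = begin
    0# * F (suc m) + (coeff (Poly.constant A 1#) *ˢ F) m  ≈⟨ +-cong (zeroˡ _) (*ˢ-cong {G = F} (coeff-constant 1#) (λ _ → refl) m) ⟩
    0# + (constantˢ 1# *ˢ F) m                            ≈⟨ +-identityˡ _ ⟩
    (constantˢ 1# *ˢ F) m                                 ≈⟨ *ˢ-identityˡ F m ⟩
    F m                                                   ∎

-- Counting Dyck words by first return

-- The recursion for size `suc m` asks only for sizes at most `m` while the fuel drops by one, so
-- fuel that suffices at the start never runs out.
dyckWordsFuelled-irrelevant : ∀ s {f g m} → m ≤ f → m ≤ g → dyckWordsFuelled s f m ≡ dyckWordsFuelled s g m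
dyckWordsFuelled-irrelevant s {zero}  {zero}  {zero}  _ _ = ≡.refl
dyckWordsFuelled-irrelevant s {zero}  {suc g} {zero}  _ _ = ≡.refl
dyckWordsFuelled-irrelevant s {suc f} {zero}  {zero}  _ _ = ≡.refl
dyckWordsFuelled-irrelevant s {suc f} {suc g} {zero}  _ _ = ≡.refl
dyckWordsFuelled-irrelevant s {suc f} {suc g} {suc m} (s≤s m≤f) (s≤s m≤g) =
  ≡.cong concat (map-cong (λ α → ≡.cong concat (map-cong-local (All.tabulate λ {i} i∈ →
    let i≤m = s≤s⁻¹ (∈-upTo⁻ i∈) in
    ≡.cong₂ (cartesianProductWith (parenthesise α))
      (dyckWordsFuelled-irrelevant s (ℕₚ.≤-trans i≤m m≤f) (ℕₚ.≤-trans i≤m m≤g))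
      (dyckWordsFuelled-irrelevant s (ℕₚ.≤-trans (ℕₚ.m∸n≤m m i) m≤f) (ℕₚ.≤-trans (ℕₚ.m∸n≤m m i) m≤g))))) (allFin s))

-- By definition both factors are enumerated with fuel `m`; resetting the fuel to their own sizes
-- turns the recursion into a convolution.
dyckWords-suc : ∀ s m → dyckWords s (suc m) ≡
  concatMap (λ α → concatMap (λ i →
    cartesianProductWith (parenthesise α) (dyckWords s i) (dyckWords s (m ∸ i)))
  (upTo (suc m))) (allFin s)
dyckWords-suc s m =
  ≡.cong concat (map-cong (λ α → ≡.cong concat (map-cong-local {xs = upTo (suc m)} (All.tabulate λ {i} i∈ →
    ≡.cong₂ (cartesianProductWith (parenthesise α))
      (dyckWordsFuelled-irrelevant s {m} (s≤s⁻¹ (∈-upTo⁻ i∈)) ℕₚ.≤-refl)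
      (dyckWordsFuelled-irrelevant s {m} (ℕₚ.m∸n≤m m i) ℕₚ.≤-refl)))) (allFin s))

module ListSum {c ℓ} (A : CommutativeRing c ℓ) where

  open CommutativeRing A hiding (zero)
  open CommutativeSemigroupProperties +-commutativeSemigroup using (interchange)
  open import Relation.Binary.Reasoning.Setoid setoid

  ∑ : ∀ {a} {X : Set a} → List X → (X → Carrier) → Carrier
  ∑ []       φ = 0#
  ∑ (x ∷ xs) φ = φ x + ∑ xs φ

  module _ {a} {X : Set a} where

    ∑-cong : ∀ (xs : List X) {φ ψ} → (∀ x → φ x ≈ ψ x) → ∑ xs φ ≈ ∑ xs ψ
    ∑-cong []       e = refl
    ∑-cong (x ∷ xs) e = +-cong (e x) (∑-cong xs e)

    ∑-+ : ∀ (xs : List X) φ ψ → ∑ xs (λ x → φ x + ψ x) ≈ ∑ xs φ + ∑ xs ψ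
    ∑-+ []       φ ψ = sym (+-identityʳ 0#)
    ∑-+ (x ∷ xs) φ ψ = trans (+-congˡ (∑-+ xs φ ψ)) (interchange _ _ _ _)

    ∑-*ʳ : ∀ (xs : List X) φ b → ∑ xs (λ x → φ x * b) ≈ ∑ xs φ * b
    ∑-*ʳ []       φ b = sym (zeroˡ b)
    ∑-*ʳ (x ∷ xs) φ b = trans (+-congˡ (∑-*ʳ xs φ b)) (sym (distribʳ _ _ _))

    ∑-*ˡ : ∀ (xs : List X) φ b → ∑ xs (λ x → b * φ x) ≈ b * ∑ xs φ
    ∑-*ˡ xs φ b = trans (∑-cong xs λ _ → *-comm _ _) (trans (∑-*ʳ xs φ b) (*-comm _ _))

    ∑-++ : ∀ (xs ys : List X) φ → ∑ (xs ++ₗ ys) φ ≈ ∑ xs φ + ∑ ys φ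
    ∑-++ []       ys φ = sym (+-identityˡ _)
    ∑-++ (x ∷ xs) ys φ = trans (+-congˡ (∑-++ xs ys φ)) (sym (+-assoc _ _ _))

    ∑-tabulate : ∀ {n} (f : Fin n → X) φ → ∑ (tabulate f) φ ≡ RawMonoidDefs.sum +-rawMonoid (φ ∘ f)
    ∑-tabulate {ℕ.zero}  f φ = ≡.refl
    ∑-tabulate {ℕ.suc n} f φ = ≡.cong₂ _+_ ≡.refl (∑-tabulate (f ∘ suc) φ)

    ∑-applyUpTo : ∀ n (f : ℕ → X) φ →
                  ∑ (applyUpTo f n) φ ≡ RawMonoidDefs.sum +-rawMonoid (λ (i : Fin n) → φ (f (toℕ i)))
    ∑-applyUpTo zero    f φ = ≡.refl
    ∑-applyUpTo (suc n) f φ = ≡.cong₂ _+_ ≡.refl (∑-applyUpTo n (f ∘ suc) φ)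

  module _ {a b} {X : Set a} {Y : Set b} where

    ∑-map : ∀ (f : X → Y) xs φ → ∑ (map f xs) φ ≡ ∑ xs (φ ∘ f)
    ∑-map f []       φ = ≡.refl
    ∑-map f (x ∷ xs) φ = ≡.cong₂ _+_ ≡.refl (∑-map f xs φ)

    ∑-concatMap : ∀ (f : X → List Y) xs φ → ∑ (concatMap f xs) φ ≈ ∑ xs (λ x → ∑ (f x) φ)
    ∑-concatMap f []       φ = refl
    ∑-concatMap f (x ∷ xs) φ = trans (∑-++ (f x) _ φ) (+-congˡ (∑-concatMap f xs φ))

    ∑-product : ∀ (xs : List X) (ys : List Y) φ ψ → ∑ xs (λ x → ∑ ys (λ y → φ x * ψ y)) ≈ ∑ xs φ * ∑ ys ψ
    ∑-product xs ys φ ψ = trans (∑-cong xs λ x → ∑-*ˡ ys ψ (φ x)) (∑-*ʳ xs φ _)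

  ∑-cartesianProductWith : ∀ {a b c} {X : Set a} {Y : Set b} {Z : Set c} (f : X → Y → Z) xs ys φ →
                           ∑ (cartesianProductWith f xs ys) φ ≈ ∑ xs (λ x → ∑ ys (λ y → φ (f x y)))
  ∑-cartesianProductWith f []       ys φ = refl
  ∑-cartesianProductWith f (x ∷ xs) ys φ = trans (∑-++ (map (f x) ys) _ φ)
    (+-cong (reflexive (∑-map (f x) ys φ)) (∑-cartesianProductWith f xs ys φ))

module DyckSeries {c ℓ} (A : CommutativeRing c ℓ) (s : ℕ) (κ : Fin s → CommutativeRing.Carrier A) where

  open CommutativeRing A hiding (zero)
  open ListSum A
  open FormalSeries A using (Series; _+ˢ_; _*ˢ_)
  open import Relation.Binary.Reasoning.Setoid setoid

  weight : ∀ {w : List (Paren (Fin s))} → Dyck w → Carrier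
  weight ε            = 0#
  weight (wrap α p q) = κ α + (weight p + weight q)

  -- G and H, with the dimensions of the ideals replaced by arbitrary weights `κ`.
  countSeries weightSeries : Series
  countSeries  m = ∑ (dyckWords s m) λ _ → 1#
  weightSeries m = ∑ (dyckWords s m) λ (_ , p) → weight p

  labelCount labelWeight : Carrier
  labelCount  = ∑ (allFin s) λ _ → 1#
  labelWeight = ∑ (allFin s) κ

  ∑-dyckWords-suc : ∀ m φ → ∑ (dyckWords s (suc m)) φ ≈
    ∑ (allFin s) λ α → ∑ (upTo (suc m)) λ i →
      ∑ (dyckWords s i) λ u → ∑ (dyckWords s (m ∸ i)) λ v → φ (parenthesise α u v)
  ∑-dyckWords-suc m φ = begin
    ∑ (dyckWords s (suc m)) φ
      ≡⟨ ≡.cong (λ ws → ∑ ws φ) (dyckWords-suc s m) ⟩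
    ∑ (concatMap (λ α → concatMap (block α) (upTo (suc m))) (allFin s)) φ
      ≈⟨ ∑-concatMap _ (allFin s) φ ⟩
    ∑ (allFin s) (λ α → ∑ (concatMap (block α) (upTo (suc m))) φ)
      ≈⟨ ∑-cong (allFin s) (λ α → trans (∑-concatMap (block α) (upTo (suc m)) φ)
           (∑-cong (upTo (suc m)) λ i →
             ∑-cartesianProductWith (parenthesise α) (dyckWords s i) (dyckWords s (m ∸ i)) φ)) ⟩
    _ ∎
    where
    block : Fin s → ℕ → List (DyckWord (Fin s))
    block α i = cartesianProductWith (parenthesise α) (dyckWords s i) (dyckWords s (m ∸ i))

  ∑-convolution : ∀ m (F G : Series) → ∑ (upTo (suc m)) (λ i → F i * G (m ∸ i)) ≈ (F *ˢ G) m
  ∑-convolution m F G = reflexive (∑-applyUpTo (suc m) (λ i → i) _)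

  countSeries-suc : ∀ m → countSeries (suc m) ≈ labelCount * (countSeries *ˢ countSeries) m
  countSeries-suc m = begin
    countSeries (suc m)
      ≈⟨ ∑-dyckWords-suc m (λ _ → 1#) ⟩
    _ ≈⟨ ∑-cong (allFin s) (λ α → begin
        _ ≈⟨ ∑-cong (upTo (suc m)) (λ i → trans
               (∑-cong (dyckWords s i) λ _ → ∑-cong (dyckWords s (m ∸ i)) λ _ → sym (*-identityˡ 1#))
               (∑-product (dyckWords s i) (dyckWords s (m ∸ i)) (λ _ → 1#) (λ _ → 1#))) ⟩
        _ ≈⟨ ∑-convolution m countSeries countSeries ⟩
        -- The terms no longer depend on `α`; the factor `1#` lets their sum over `α` be written as
        -- `labelCount` times the common value.
        _ ≈⟨ *-identityˡ _ ⟨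
        _ ∎) ⟩
    _ ≈⟨ ∑-*ʳ (allFin s) (λ _ → 1#) _ ⟩
    labelCount * (countSeries *ˢ countSeries) m
      ∎

  -- The weight splits into that of the first pair, of the inner word and of the remaining word;
  -- summed over all choices these give A G², s H G and s G H.
  weightSeries-suc : ∀ m → weightSeries (suc m) ≈
    labelWeight * (countSeries *ˢ countSeries) m +
    labelCount * ((weightSeries *ˢ countSeries) m + (countSeries *ˢ weightSeries) m)
  weightSeries-suc m = begin
    weightSeries (suc m)
      ≈⟨ ∑-dyckWords-suc m _ ⟩
    _ ≈⟨ ∑-cong (allFin s) (λ α → begin
        _ ≈⟨ ∑-cong (upTo (suc m)) (pairs α) ⟩
        _ ≈⟨ ∑-+ (upTo (suc m)) _ _ ⟩
        _ ≈⟨ +-cong (trans (∑-*ˡ (upTo (suc m)) _ (κ α)) (*-congˡ (∑-convolution m countSeries countSeries)))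
               (trans (∑-+ (upTo (suc m)) _ _)
                 (+-cong (∑-convolution m weightSeries countSeries) (∑-convolution m countSeries weightSeries))) ⟩
        _ ≈⟨ +-congˡ (*-identityˡ _) ⟨
        _ ∎) ⟩
    _ ≈⟨ ∑-+ (allFin s) _ _ ⟩
    _ ≈⟨ +-cong (∑-*ʳ (allFin s) κ _) (∑-*ʳ (allFin s) (λ _ → 1#) _) ⟩
    _ ∎
    where
    -- Each summand is made a function of the first word times a function of the second, with `1#`
    -- for a missing factor, so that `∑-product` applies.
    pairs : ∀ α i → ∑ (dyckWords s i) (λ (_ , p) → ∑ (dyckWords s (m ∸ i)) λ (_ , q) → κ α + (weight p + weight q)) ≈
      κ α * (countSeries i * countSeries (m ∸ i)) +
      (weightSeries i * countSeries (m ∸ i) + countSeries i * weightSeries (m ∸ i))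
    pairs α i = begin
      _ ≈⟨ ∑-cong U (λ _ → ∑-+ V _ _) ⟩
      _ ≈⟨ ∑-+ U _ _ ⟩
      _ ≈⟨ +-cong
        (trans (∑-cong U λ _ → trans (∑-cong V λ _ → trans (sym (*-identityʳ _)) (*-congˡ (sym (*-identityˡ 1#))))
            (∑-*ˡ V _ (κ α)))
          (trans (∑-*ˡ U _ (κ α)) (*-congˡ (∑-product U V (λ _ → 1#) (λ _ → 1#)))))
        (trans (∑-cong U λ _ → trans (∑-+ V _ _)
            (+-cong (∑-cong V λ _ → sym (*-identityʳ _)) (∑-cong V λ _ → sym (*-identityˡ _))))
          (trans (∑-+ U _ _) (+-cong (∑-product U V _ (λ _ → 1#)) (∑-product U V (λ _ → 1#) _)))) ⟩
      _ ∎
      where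
      U = dyckWords s i
      V = dyckWords s (m ∸ i)

-- Elimination of G and H

module Eliminant {c ℓ} (R : CommutativeRing c ℓ) where

  open CommutativeRing R

  Δ : (s t : Carrier) → Carrier
  Δ s t = 1# - t * ((s + s) + (s + s))

  -- The coefficients of 1, x and x², over any ring because they are needed twice: in ℚ[t] as the
  -- polynomial, and in ℚ⟦t⟧ where its root is verified. Keeping `δ` as an argument spares the
  -- homomorphism lemmas the expansion of Δ.
  e₀ e₁ e₂ : (s t D A δ : Carrier) → Carrier
  e₀ s t D A δ = δ * (D * (s * D - A)) - t * (A * A)
  e₁ s t D A δ = - (δ * (s * D - A))
  e₂ s t D A δ = t * (s * (s * δ))

module EliminantHomomorphism {c ℓ c′ ℓ′} {R : CommutativeRing c ℓ} {R′ : CommutativeRing c′ ℓ′}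
  (f : RingHomomorphism (CommutativeRing.rawRing R) (CommutativeRing.rawRing R′)) where

  private
    module R = CommutativeRing R
    module E = Eliminant R
    module E′ = Eliminant R′
  open CommutativeRing R′
  open RingHomomorphism f

  ⟦⟧-difference : ∀ x y → ⟦ x R.- y ⟧ ≈ ⟦ x ⟧ - ⟦ y ⟧
  ⟦⟧-difference x y = trans (+-homo x (R.- y)) (+-congˡ (-‿homo y))

  ⟦⟧-double : ∀ x → ⟦ (x R.+ x) R.+ (x R.+ x) ⟧ ≈ (⟦ x ⟧ + ⟦ x ⟧) + (⟦ x ⟧ + ⟦ x ⟧)
  ⟦⟧-double x = trans (+-homo _ _) (+-cong (+-homo x x) (+-homo x x))

  Δ-homo : ∀ s t → ⟦ E.Δ s t ⟧ ≈ E′.Δ ⟦ s ⟧ ⟦ t ⟧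
  Δ-homo s t = trans (⟦⟧-difference _ _) (+-cong 1#-homo (-‿cong (trans (*-homo _ _) (*-congˡ (⟦⟧-double s)))))

  module _ (s t D A δ : R.Carrier) where

    private
      sD-A-homo : ⟦ s R.* D R.- A ⟧ ≈ ⟦ s ⟧ * ⟦ D ⟧ - ⟦ A ⟧
      sD-A-homo = trans (⟦⟧-difference _ _) (+-congʳ (*-homo s D))

    e₀-homo : ⟦ E.e₀ s t D A δ ⟧ ≈ E′.e₀ ⟦ s ⟧ ⟦ t ⟧ ⟦ D ⟧ ⟦ A ⟧ ⟦ δ ⟧
    e₀-homo = trans (⟦⟧-difference _ _) (+-cong
      (trans (*-homo _ _) (*-congˡ (trans (*-homo _ _) (*-congˡ sD-A-homo))))
      (-‿cong (trans (*-homo _ _) (*-congˡ (*-homo A A)))))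

    e₁-homo : ⟦ E.e₁ s t D A δ ⟧ ≈ E′.e₁ ⟦ s ⟧ ⟦ t ⟧ ⟦ D ⟧ ⟦ A ⟧ ⟦ δ ⟧
    e₁-homo = trans (-‿homo _) (-‿cong (trans (*-homo _ _) (*-congˡ sD-A-homo)))

    e₂-homo : ⟦ E.e₂ s t D A δ ⟧ ≈ E′.e₂ ⟦ s ⟧ ⟦ t ⟧ ⟦ D ⟧ ⟦ A ⟧ ⟦ δ ⟧
    e₂-homo = trans (*-homo _ _) (*-congˡ (trans (*-homo _ _) (*-congˡ (*-homo s δ))))

module Elimination {c ℓ} (R : CommutativeRing c ℓ)
  (φ : CommutativeRing.rawRing ℤₚ.+-*-commutativeRing -Raw-AlmostCommutative⟶ fromCommutativeRing R) where

  open CommutativeRing R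
  open GroupProperties +-group using () renaming (x≈y⇒x∙y⁻¹≈ε to x≈y⇒x-y≈0)
  open _-Raw-AlmostCommutative⟶_ φ using (⟦_⟧; 1-homo; 0-homo)
  open Eliminant R

  private
    -- Equality in `R` need not be decidable, so the solver compares integer coefficients; this is
    -- why `⟦ + 1 ⟧` and `⟦ + 0 ⟧` stand for `1#` and `0#` in the identities it proves.
    _≟ᵢ_ : ∀ i j → Maybe (⟦ i ⟧ ≈ ⟦ j ⟧)
    i ≟ᵢ j with i ℤₚ.≟ j
    ... | yes ≡.refl = just refl
    ... | no _       = nothing

  module Solver = Algebra.Solver.Ring (CommutativeRing.rawRing ℤₚ.+-*-commutativeRing) (fromCommutativeRing R) φ _≟ᵢ_
  open Solver using (solve; _:=_; _:+_; _:*_; _:-_; :-_; con)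

  -- The cofactors come from substituting F = DG + H and reducing with s t G² = G - 1 - r₁ and
  -- H (1 - 2 s t G) = A t G² + r₂, where r₁ and r₂ are the defects of the two functional equations.
  cofactors : ∀ s t D A G H →
    let one = ⟦ + 1 ⟧; δ = one - t * ((s + s) + (s + s)); F = D * G + H
        r₁ = G - (one + t * (s * (G * G))); r₂ = H - t * (A * (G * G) + s * (H * G + G * H))
        w = s * r₂ - A * r₁ + (A + A) * (G - one)
    in
    e₀ s t D A δ + F * (e₁ s t D A δ + F * (e₂ s t D A δ + F * ⟦ + 0 ⟧)) ≈
    (δ * (D * A - s * (D * D)) + t * ((s + s) + (s + s)) * (A * H + s * s * t * (H * H))
      + (A * A * t * G + A * A * t * G) - t * (A * w)) * r₁
    + (A * (one - t * ((s + s) * G)) - δ * s * D + t * s * w) * r₂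
  cofactors = solve 6 (λ s t D A G H →
    let one = con (+ 1); δ = one :- t :* ((s :+ s) :+ (s :+ s)); F = D :* G :+ H
        r₁ = G :- (one :+ t :* (s :* (G :* G))); r₂ = H :- t :* (A :* (G :* G) :+ s :* (H :* G :+ G :* H))
        w = s :* r₂ :- A :* r₁ :+ (A :+ A) :* (G :- one)
    in
    (δ :* (D :* (s :* D :- A)) :- t :* (A :* A))
      :+ F :* (:- (δ :* (s :* D :- A)) :+ F :* (t :* (s :* (s :* δ)) :+ F :* con (+ 0))) :=
    (δ :* (D :* A :- s :* (D :* D)) :+ t :* ((s :+ s) :+ (s :+ s)) :* (A :* H :+ s :* s :* t :* (H :* H))
      :+ (A :* A :* t :* G :+ A :* A :* t :* G) :- t :* (A :* w)) :* r₁
    :+ (A :* (one :- t :* ((s :+ s) :* G)) :- δ :* s :* D :+ t :* s :* w) :* r₂) refl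

  -- Once F and Δ are substituted, `cofactors` writes the left side as a combination of the defects
  -- of the two functional equations, and both defects vanish.
  elimination : ∀ {s t D A G H F δ} →
    G ≈ 1# + t * (s * (G * G)) → H ≈ t * (A * (G * G) + s * (H * G + G * H)) → F ≈ D * G + H → δ ≈ Δ s t →
    e₀ s t D A δ + F * (e₁ s t D A δ + F * (e₂ s t D A δ + F * 0#)) ≈ 0#
  elimination {s} {t} {D} {A} {G} {H} {F} {δ} eG eH eF eδ =
    trans (+-cong (+-congʳ (*-congʳ δ≈)) (*-cong eF (+-cong (-‿cong (*-congʳ δ≈))
      (*-cong eF (+-cong (*-congˡ (*-congˡ (*-congˡ δ≈))) (*-cong eF (sym 0-homo)))))))
    (trans (cofactors s t D A G H)
    (trans (+-cong (*-congˡ (x≈y⇒x-y≈0 (trans eG (+-congʳ (sym 1-homo))))) (*-congˡ (x≈y⇒x-y≈0 eH)))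
    (trans (+-cong (zeroʳ _) (zeroʳ _)) (+-identityʳ 0#))))
    where
    δ≈ : δ ≈ ⟦ + 1 ⟧ - t * ((s + s) + (s + s))
    δ≈ = trans eδ (+-congʳ (sym 1-homo))

  -- Horner form of the linear polynomial with constant term `- x` and leading coefficient 1,
  -- evaluated at `x`; it serves the case without labels.
  elimination₀ : ∀ x → - x + x * (1# + x * 0#) ≈ 0#
  elimination₀ x = trans (+-congˡ (*-congˡ (+-cong (sym 1-homo) (*-congˡ (sym 0-homo)))))
    (trans (solve 1 (λ x → :- x :+ x :* (con (+ 1) :+ x :* con (+ 0)) := con (+ 0)) refl x) 0-homo)

-- Algebraicity of a Hilbert-Dyck series with edge-additive dimensions

edgeWeight : ∀ {L} → (L → ℕ) → ∀ {w : List (Paren L)} → Dyck w → ℕ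
edgeWeight a ε            = 0
edgeWeight a (wrap α p q) = a α ℕ.+ (edgeWeight a p ℕ.+ edgeWeight a q)

module RationalSeries where

  fromℤ : ℤ → ℚ
  fromℤ i = i / 1

  private
    toℚᵘ-fromℤ : ∀ i → toℚᵘ (fromℤ i) ℚᵘ.≃ ℚᵘ.mkℚᵘ i 0
    toℚᵘ-fromℤ i = ℚₚ.toℚᵘ-fromℚᵘ (ℚᵘ.mkℚᵘ i 0)

  -- Since `_/_` reduces by the gcd, the computation moves to unnormalised rationals, where the
  -- denominator 1 stays visible.
  fromℤ-+ : ∀ i j → fromℤ (i ℤ.+ j) ≡ fromℤ i ℚ.+ fromℤ j
  fromℤ-+ i j = ℚₚ.toℚᵘ-injective (begin-equality
    toℚᵘ (fromℤ (i ℤ.+ j))               ≃⟨ toℚᵘ-fromℤ _ ⟩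
    ℚᵘ.mkℚᵘ (i ℤ.+ j) 0                  ≃⟨ ℚᵘ.*≡* (≡.cong (ℤ._* + 1)
                                                 (≡.cong₂ ℤ._+_ (≡.sym (ℤₚ.*-identityʳ i)) (≡.sym (ℤₚ.*-identityʳ j)))) ⟩
    ℚᵘ.mkℚᵘ i 0 ℚᵘ.+ ℚᵘ.mkℚᵘ j 0         ≃⟨ ℚᵘₚ.+-cong (toℚᵘ-fromℤ i) (toℚᵘ-fromℤ j) ⟨
    toℚᵘ (fromℤ i) ℚᵘ.+ toℚᵘ (fromℤ j)   ≃⟨ ℚₚ.toℚᵘ-homo-+ (fromℤ i) (fromℤ j) ⟨
    toℚᵘ (fromℤ i ℚ.+ fromℤ j)           ∎)
    where open ℚᵘₚ.≤-Reasoning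

  fromℤ-* : ∀ i j → fromℤ (i ℤ.* j) ≡ fromℤ i ℚ.* fromℤ j
  fromℤ-* i j = ℚₚ.toℚᵘ-injective (begin-equality
    toℚᵘ (fromℤ (i ℤ.* j))               ≃⟨ toℚᵘ-fromℤ _ ⟩
    ℚᵘ.mkℚᵘ i 0 ℚᵘ.* ℚᵘ.mkℚᵘ j 0         ≃⟨ ℚᵘₚ.*-cong (toℚᵘ-fromℤ i) (toℚᵘ-fromℤ j) ⟨
    toℚᵘ (fromℤ i) ℚᵘ.* toℚᵘ (fromℤ j)   ≃⟨ ℚₚ.toℚᵘ-homo-* (fromℤ i) (fromℤ j) ⟨
    toℚᵘ (fromℤ i ℚ.* fromℤ j)           ∎)
    where open ℚᵘₚ.≤-Reasoning

  fromℤ-neg : ∀ i → fromℤ (ℤ.- i) ≡ ℚ.- fromℤ i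
  fromℤ-neg i = ℚₚ.toℚᵘ-injective (begin-equality
    toℚᵘ (fromℤ (ℤ.- i))    ≃⟨ toℚᵘ-fromℤ _ ⟩
    ℚᵘ.- ℚᵘ.mkℚᵘ i 0        ≃⟨ ℚᵘₚ.-‿cong (toℚᵘ-fromℤ i) ⟨
    ℚᵘ.- toℚᵘ (fromℤ i)     ≃⟨ ℚₚ.toℚᵘ-homo‿- (fromℤ i) ⟨
    toℚᵘ (ℚ.- fromℤ i)      ∎)
    where open ℚᵘₚ.≤-Reasoning

  fromℤ-injective : ∀ {i j} → fromℤ i ≡ fromℤ j → i ≡ j
  fromℤ-injective {i} {j} e = begin
    i           ≡⟨ ℤₚ.*-identityʳ i ⟨
    i ℤ.* + 1   ≡⟨ ℚᵘₚ.drop-*≡* (ℚₚ.fromℚᵘ-injective {ℚᵘ.mkℚᵘ i 0} {ℚᵘ.mkℚᵘ j 0} e) ⟩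
    j ℤ.* + 1   ≡⟨ ℤₚ.*-identityʳ j ⟩
    j           ∎
    where open ≡.≡-Reasoning

  fromℕ : ℕ → ℚ
  fromℕ n = fromℤ (+ n)

  fromℕ-+ : ∀ m n → fromℕ (m ℕ.+ n) ≡ fromℕ m ℚ.+ fromℕ n
  fromℕ-+ m n = fromℤ-+ (+ m) (+ n)

  ℚ-ring ℚ⟦t⟧ : CommutativeRing _ _
  ℚ-ring = ℚₚ.+-*-commutativeRing
  ℚ⟦t⟧   = FormalSeries.commutativeRing ℚ-ring

  open FormalSeries ℚ-ring
  open ListSum ℚ-ring
  open Poly ℚ-ring using (coeff; constant; indeterminate; coeff-+; coeff-neg)
  private module ℚ[[t]] = CommutativeRing ℚ⟦t⟧

  ℤ→ℚ⟦t⟧ : CommutativeRing.rawRing ℤₚ.+-*-commutativeRing -Raw-AlmostCommutative⟶ fromCommutativeRing ℚ⟦t⟧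
  ℤ→ℚ⟦t⟧ = record
    { ⟦_⟧    = constantˢ ∘ fromℤ
    ; +-homo = λ { i j zero → fromℤ-+ i j ; i j (suc m) → ≡.refl }
    ; *-homo = λ { i j zero    → ≡.trans (fromℤ-* i j) (≡.sym (constantˢ-*ˢ (fromℤ i) (constantˢ (fromℤ j)) 0))
                 ; i j (suc m) → ≡.sym (≡.trans (constantˢ-*ˢ (fromℤ i) (constantˢ (fromℤ j)) (suc m)) (ℚₚ.*-zeroʳ (fromℤ i))) }
    ; -‿homo = λ { i zero → fromℤ-neg i ; i (suc m) → ≡.refl }
    ; 0-homo = λ { zero → ≡.refl ; (suc m) → ≡.refl }
    ; 1-homo = λ { zero → ≡.refl ; (suc m) → ≡.refl }
    }

  open Elimination ℚ⟦t⟧ ℤ→ℚ⟦t⟧ using (elimination; elimination₀)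

  coeff-homomorphism : RingHomomorphism (CommutativeRing.rawRing ℚ[t]) (CommutativeRing.rawRing ℚ⟦t⟧)
  coeff-homomorphism = record
    { ⟦_⟧ = coeff
    ; isRingHomomorphism = record
      { isSemiringHomomorphism = record
        { isNearSemiringHomomorphism = record
          { +-isMonoidHomomorphism = record
            { isMagmaHomomorphism = record
              { isRelHomomorphism = record { cong = Poly.at }
              ; homo              = coeff-+
              }
            ; ε-homo = λ _ → ≡.refl
            }
          ; *-homo = coeff-*
          }
        ; 1#-homo = coeff-constant ℚ.1ℚ
        }
      ; -‿homo = coeff-neg
      }
    }

  fromℕ-sum : ∀ {a} {X : Set a} (f : X → ℕ) xs → fromℕ (sumℕ (map f xs)) ≡ ∑ xs (fromℕ ∘ f)
  fromℕ-sum f []       = ≡.refl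
  fromℕ-sum f (x ∷ xs) = ≡.trans (fromℕ-+ (f x) _) (≡.cong (fromℕ (f x) ℚ.+_) (fromℕ-sum f xs))

  ∑-ones : ∀ n → ∑ (allFin n) (λ _ → ℚ.1ℚ) ≡ fromℕ n
  ∑-ones n = ≡.trans (∑-tabulate (λ (i : Fin n) → i) (λ _ → ℚ.1ℚ)) (sum-ones n)
    where
    sum-ones : ∀ n → RawMonoidDefs.sum ℚ.+-0-rawMonoid (λ (_ : Fin n) → ℚ.1ℚ) ≡ fromℕ n
    sum-ones zero    = ≡.refl
    sum-ones (suc n) = ≡.trans (≡.cong (ℚ.1ℚ ℚ.+_) (sum-ones n)) (≡.sym (fromℕ-+ 1 n))

  module _ (s D : ℕ) (a : Fin s → ℕ) (dim : DyckWord (Fin s) → ℕ)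
    (dim≡ : ∀ w → dim w ≡ D ℕ.+ edgeWeight a (proj₂ w)) where

    open DyckSeries ℚ-ring s (fromℕ ∘ a)

    private
      F = hilbertDyckSeries dim
      G = countSeries
      H = weightSeries

      module P = CommutativeRing ℚ[t]
      S̃ D̃ Ã : P.Carrier
      S̃ = constant labelCount
      D̃ = constant (fromℕ D)
      Ã = constant labelWeight
      t = indeterminate

      constant-* : ∀ x F m → (coeff (constant x) *ˢ F) m ≡ x ℚ.* F m
      constant-* x F m = ≡.trans (*ˢ-cong {G = F} (coeff-constant x) (λ _ → ≡.refl) m) (constantˢ-*ˢ x F m)

    fromℕ-edgeWeight : ∀ {w} (p : Dyck w) → fromℕ (edgeWeight a p) ≡ weight p
    fromℕ-edgeWeight ε            = ≡.refl
    fromℕ-edgeWeight (wrap α p q) = ≡.trans (fromℕ-+ (a α) _) (≡.cong (fromℕ (a α) ℚ.+_)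
      (≡.trans (fromℕ-+ (edgeWeight a p) _) (≡.cong₂ ℚ._+_ (fromℕ-edgeWeight p) (fromℕ-edgeWeight q))))

    hilbertDyckSeries-linear : F ≋ coeff D̃ *ˢ G +ˢ H
    hilbertDyckSeries-linear m = begin
      fromℕ (sumℕ (map dim W))                                  ≡⟨ fromℕ-sum dim W ⟩
      ∑ W (fromℕ ∘ dim)                                        ≡⟨ ∑-cong W pointwise ⟩
      ∑ W (λ w → fromℕ D ℚ.* ℚ.1ℚ ℚ.+ weight (proj₂ w))        ≡⟨ ∑-+ W _ _ ⟩
      ∑ W (λ w → fromℕ D ℚ.* ℚ.1ℚ) ℚ.+ H m                     ≡⟨ ≡.cong (ℚ._+ H m) (∑-*ˡ W _ (fromℕ D)) ⟩
      fromℕ D ℚ.* G m ℚ.+ H m                                  ≡⟨ ≡.cong (ℚ._+ H m) (constant-* (fromℕ D) G m) ⟨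
      (coeff D̃ *ˢ G) m ℚ.+ H m                                 ∎
      where
      open ≡.≡-Reasoning
      W = dyckWords s m
      pointwise : ∀ w → fromℕ (dim w) ≡ fromℕ D ℚ.* ℚ.1ℚ ℚ.+ weight (proj₂ w)
      pointwise w@(_ , p) = ≡.trans (≡.cong fromℕ (dim≡ w)) (≡.trans (fromℕ-+ D _)
        (≡.cong₂ ℚ._+_ (≡.sym (ℚₚ.*-identityʳ (fromℕ D))) (fromℕ-edgeWeight p)))

    countSeries-equation : G ≋ constantˢ ℚ.1ℚ +ˢ coeff t *ˢ (coeff S̃ *ˢ (G *ˢ G))
    countSeries-equation zero    = ≡.sym (≡.cong (ℚ.1ℚ ℚ.+_) (indeterminate-*ˢ (coeff S̃ *ˢ (G *ˢ G)) 0))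
    countSeries-equation (suc m) = begin
      G (suc m)                                             ≡⟨ countSeries-suc m ⟩
      labelCount ℚ.* (G *ˢ G) m                             ≡⟨ constant-* labelCount (G *ˢ G) m ⟨
      (coeff S̃ *ˢ (G *ˢ G)) m                               ≡⟨ indeterminate-*ˢ (coeff S̃ *ˢ (G *ˢ G)) (suc m) ⟨
      (coeff t *ˢ (coeff S̃ *ˢ (G *ˢ G))) (suc m)            ≡⟨ ℚₚ.+-identityˡ _ ⟨
      ℚ.0ℚ ℚ.+ (coeff t *ˢ (coeff S̃ *ˢ (G *ˢ G))) (suc m)   ∎
      where open ≡.≡-Reasoning

    weightSeries-equation : H ≋ coeff t *ˢ (coeff Ã *ˢ (G *ˢ G) +ˢ coeff S̃ *ˢ (H *ˢ G +ˢ G *ˢ H))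
    weightSeries-equation zero    = ≡.sym (indeterminate-*ˢ (coeff Ã *ˢ (G *ˢ G) +ˢ coeff S̃ *ˢ (H *ˢ G +ˢ G *ˢ H)) 0)
    weightSeries-equation (suc m) = begin
      H (suc m)
        ≡⟨ weightSeries-suc m ⟩
      labelWeight ℚ.* (G *ˢ G) m ℚ.+ labelCount ℚ.* (H *ˢ G +ˢ G *ˢ H) m
        ≡⟨ ≡.cong₂ ℚ._+_ (constant-* labelWeight (G *ˢ G) m) (constant-* labelCount (H *ˢ G +ˢ G *ˢ H) m) ⟨
      (coeff Ã *ˢ (G *ˢ G)) m ℚ.+ (coeff S̃ *ˢ (H *ˢ G +ˢ G *ˢ H)) m
        ≡⟨ indeterminate-*ˢ (coeff Ã *ˢ (G *ˢ G) +ˢ coeff S̃ *ˢ (H *ˢ G +ˢ G *ˢ H)) (suc m) ⟨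
      (coeff t *ˢ (coeff Ã *ˢ (G *ˢ G) +ˢ coeff S̃ *ˢ (H *ˢ G +ˢ G *ˢ H))) (suc m)
        ∎
      where open ≡.≡-Reasoning

    private
      δ : P.Carrier
      δ = Eliminant.Δ ℚ[t] S̃ t

      open Eliminant ℚ[t] using (e₀; e₁; e₂)
      open EliminantHomomorphism {R = ℚ[t]} {ℚ⟦t⟧} coeff-homomorphism using (Δ-homo; e₀-homo; e₁-homo; e₂-homo)

      quadratic : CommutativeRing.Carrier ℚ[t][x]
      quadratic = e₀ S̃ t D̃ Ã δ ∷ e₁ S̃ t D̃ Ã δ ∷ e₂ S̃ t D̃ Ã δ ∷ []

      module S = ℚ[[t]]

    quadratic-root : ∀ m → evaluate quadratic F m ≡ ℚ.0ℚ
    quadratic-root = S.trans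
      (S.+-cong (e₀-homo S̃ t D̃ Ã δ) (F*-cong (S.+-cong (e₁-homo S̃ t D̃ Ã δ) (F*-cong (S.+-congʳ (e₂-homo S̃ t D̃ Ã δ))))))
      (elimination {coeff S̃} {coeff t} {coeff D̃} {coeff Ã} {G} {H} {F}
        countSeries-equation weightSeries-equation hilbertDyckSeries-linear (Δ-homo S̃ t))
      where
      F*-cong : ∀ {X Y} → X ≋ Y → F *ˢ X ≋ F *ˢ Y
      F*-cong {X} {Y} = *ˢ-cong {F} {F} {X} {Y} (λ _ → ≡.refl)

    -- `e₂` is t s² δ and δ has constant term 1, so s² is the coefficient of t x² in the quadratic;
    -- for s ≠ 0 this shows that the quadratic is not zero.
    leading-coefficient : coeff (e₂ S̃ t D̃ Ã δ) 1 ≡ labelCount ℚ.* labelCount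
    leading-coefficient = begin
      coeff (e₂ S̃ t D̃ Ã δ) 1                                ≡⟨ e₂-homo S̃ t D̃ Ã δ 1 ⟩
      (coeff t *ˢ (coeff S̃ *ˢ (coeff S̃ *ˢ coeff δ))) 1      ≡⟨ indeterminate-*ˢ (coeff S̃ *ˢ (coeff S̃ *ˢ coeff δ)) 1 ⟩
      (coeff S̃ *ˢ (coeff S̃ *ˢ coeff δ)) 0                   ≡⟨ constant-* labelCount (coeff S̃ *ˢ coeff δ) 0 ⟩
      labelCount ℚ.* (coeff S̃ *ˢ coeff δ) 0                 ≡⟨ ≡.cong (labelCount ℚ.*_) (constant-* labelCount (coeff δ) 0) ⟩
      labelCount ℚ.* (labelCount ℚ.* coeff δ 0)             ≡⟨ ≡.cong (λ x → labelCount ℚ.* (labelCount ℚ.* x)) constant-term ⟩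
      labelCount ℚ.* (labelCount ℚ.* ℚ.1ℚ)                  ≡⟨ ≡.cong (labelCount ℚ.*_) (ℚₚ.*-identityʳ labelCount) ⟩
      labelCount ℚ.* labelCount                             ∎
      where
      open ≡.≡-Reasoning
      constant-term : coeff δ 0 ≡ ℚ.1ℚ
      constant-term = ≡.trans (Δ-homo S̃ t 0) (≡.cong (λ x → ℚ.1ℚ ℚ.- x)
        (indeterminate-*ˢ ((coeff S̃ +ˢ coeff S̃) +ˢ (coeff S̃ +ˢ coeff S̃)) 0))

    hilbertDyckSeries-algebraic-suc : ℕ.NonZero s → Algebraic F
    hilbertDyckSeries-algebraic-suc s≢0 = quadratic , nonzero , quadratic-root
      where
      nonzero : ¬ (CommutativeRing._≈_ ℚ[t][x] quadratic [])
      nonzero e = ℕ.≢-nonZero⁻¹ (s ℕ.* s) {{ℕₚ.m*n≢0 s s {{s≢0}} {{s≢0}}}}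
        (ℤₚ.+-injective (fromℤ-injective (begin
          fromℤ (+ (s ℕ.* s))           ≡⟨ ≡.cong fromℤ (ℤₚ.pos-* s s) ⟩
          fromℤ (+ s ℤ.* + s)           ≡⟨ fromℤ-* (+ s) (+ s) ⟩
          fromℕ s ℚ.* fromℕ s           ≡⟨ ≡.cong₂ ℚ._*_ (∑-ones s) (∑-ones s) ⟨
          labelCount ℚ.* labelCount     ≡⟨ leading-coefficient ⟨
          coeff (e₂ S̃ t D̃ Ã δ) 1        ≡⟨ Poly.at (Poly.at e 2) 1 ⟩
          ℚ.0ℚ                          ∎)))
        where open ≡.≡-Reasoning

  hilbertDyckSeries-algebraic : ∀ s D (a : Fin s → ℕ) dim → (∀ w → dim w ≡ D ℕ.+ edgeWeight a (proj₂ w)) →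
                                Algebraic (hilbertDyckSeries dim)
  hilbertDyckSeries-algebraic (suc s) D a dim dim≡ = hilbertDyckSeries-algebraic-suc (suc s) D a dim dim≡ _
  hilbertDyckSeries-algebraic zero    D a dim dim≡ =
    -- Without labels only the empty word contributes, and the polynomial is x - D.
    (constant (ℚ.- fromℕ D) ∷ constant ℚ.1ℚ ∷ []) , nonzero ,
    S.trans (S.+-cong {u = F *ˢ (coeff (constant ℚ.1ℚ) +ˢ F *ˢ 0ˢ)} -D≈-F (S.*-congˡ {F} (S.+-congʳ (coeff-constant ℚ.1ℚ))))
      (elimination₀ F)
    where
    F = hilbertDyckSeries dim
    module S = ℚ[[t]]

    nonzero : ¬ (CommutativeRing._≈_ ℚ[t][x] (constant (ℚ.- fromℕ D) ∷ constant ℚ.1ℚ ∷ []) [])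
    nonzero e with () ← Poly.at (Poly.at e 1) 0

    -D≈-F : coeff (constant (ℚ.- fromℕ D)) ≋ -ˢ F
    -D≈-F zero    = ≡.cong (λ n → ℚ.- fromℕ n) (≡.sym
      (≡.trans (ℕₚ.+-identityʳ _) (≡.trans (dim≡ ([] , ε)) (ℕₚ.+-identityʳ D))))
    -D≈-F (suc m) = ≡.refl

open RationalSeries using (hilbertDyckSeries-algebraic)

-- Linear algebra over a Heyting field

module LinearMaps {c ℓ} {K : CommutativeRing c ℓ} where

  open CommutativeRing K hiding (zero)

  record IsLinear {m ℓm n ℓn} (M : Module K m ℓm) (N : Module K n ℓn)
                  (f : Module.Carrierᴹ M → Module.Carrierᴹ N) : Set (c ⊔ m ⊔ ℓm ⊔ ℓn) where
    private
      module M = Module M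
      module N = Module N
    field
      ⟦⟧-cong : ∀ {x y} → x M.≈ᴹ y → f x N.≈ᴹ f y
      +-homo  : ∀ x y → f (x M.+ᴹ y) N.≈ᴹ f x N.+ᴹ f y
      *ₗ-homo : ∀ a x → f (a M.*ₗ x) N.≈ᴹ a N.*ₗ f x

    0-homo : f M.0ᴹ N.≈ᴹ N.0ᴹ
    0-homo = N.≈ᴹ-trans (⟦⟧-cong (M.≈ᴹ-sym (M.*ₗ-zeroˡ M.0ᴹ))) (N.≈ᴹ-trans (*ₗ-homo 0# M.0ᴹ) (N.*ₗ-zeroˡ _))

    combination-homo : ∀ {n} (x : Vector Carrier n) b → f (combination M x b) N.≈ᴹ combination N x (f ∘ b)
    combination-homo {zero}  x b = 0-homo
    combination-homo {suc n} x b = N.≈ᴹ-trans (+-homo _ _)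
      (N.+ᴹ-cong (*ₗ-homo (x 0F) (b 0F)) (combination-homo (x ∘ suc) (b ∘ suc)))

  inclusion-linear : ∀ {m ℓm p} {M : Module K m ℓm} (N : Submodule M p) → IsLinear (submodule N) M proj₁
  inclusion-linear {M = M} N = record
    { ⟦⟧-cong = λ e → e ; +-homo = λ _ _ → Module.≈ᴹ-refl M ; *ₗ-homo = λ _ _ → Module.≈ᴹ-refl M }

  module _ {m ℓm} (M : Module K m ℓm) where

    open Module M
    open MonoidSum +ᴹ-commutativeMonoid using (sum; sum-cong-≋; sum-remove; ∑-distrib-+)
    open import Relation.Binary.Reasoning.Setoid ≈ᴹ-setoid

    combination-cong : ∀ {n} {x y : Vector Carrier n} b → (∀ i → x i ≈ y i) → combination M x b ≈ᴹ combination M y b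
    combination-cong b e = sum-cong-≋ λ i → *ₗ-cong (e i) ≈ᴹ-refl

    combination-+ : ∀ {n} (x y : Vector Carrier n) b →
                    combination M (λ i → x i + y i) b ≈ᴹ combination M x b +ᴹ combination M y b
    combination-+ x y b = ≈ᴹ-trans
      (sum-cong-≋ λ i → *ₗ-distribʳ (b i) (x i) (y i)) (∑-distrib-+ (λ i → x i *ₗ b i) (λ i → y i *ₗ b i))

    combination-* : ∀ {n} a (x : Vector Carrier n) b → combination M (λ i → a * x i) b ≈ᴹ a *ₗ combination M x b
    combination-* {zero}  a x b = ≈ᴹ-sym (*ₗ-zeroʳ a)
    combination-* {suc n} a x b = ≈ᴹ-trans
      (+ᴹ-cong (*ₗ-assoc a _ _) (combination-* a (x ∘ suc) (b ∘ suc))) (≈ᴹ-sym (*ₗ-distribˡ a _ _))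

    combination-0 : ∀ {n} (x : Vector Carrier n) b → (∀ i → x i ≈ 0#) → combination M x b ≈ᴹ 0ᴹ
    combination-0 {zero}  x b e = ≈ᴹ-refl
    combination-0 {suc n} x b e = ≈ᴹ-trans
      (+ᴹ-cong (≈ᴹ-trans (*ₗ-cong (e 0F) ≈ᴹ-refl) (*ₗ-zeroˡ _)) (combination-0 (x ∘ suc) (b ∘ suc) (e ∘ suc))) (+ᴹ-identityʳ 0ᴹ)

    combination-remove : ∀ {n} i (x : Vector Carrier (suc n)) b →
                         combination M x b ≈ᴹ x i *ₗ b i +ᴹ combination M (removeAt x i) (removeAt b i)
    combination-remove i x b = sum-remove {i = i} λ j → x j *ₗ b j

    combination-split : ∀ {p q} (x : Vector Carrier (p ℕ.+ q)) (b : Vector Carrierᴹ p) (b′ : Vector Carrierᴹ q) →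
      combination M x (b ++ b′) ≈ᴹ combination M (λ i → x (i ↑ˡ q)) b +ᴹ combination M (λ i → x (p ↑ʳ i)) b′
    combination-split {p} {q} x b b′ = ≈ᴹ-trans (sum-split p _) (+ᴹ-cong
      (sum-cong-≋ λ i → *ₗ-cong refl (≈ᴹ-reflexive (lookup-++ˡ b b′ i)))
      (sum-cong-≋ λ i → *ₗ-cong refl (≈ᴹ-reflexive (lookup-++ʳ b b′ i))))
      where
      sum-split : ∀ p (t : Vector Carrierᴹ (p ℕ.+ q)) → sum t ≈ᴹ sum (λ i → t (i ↑ˡ q)) +ᴹ sum (λ i → t (p ↑ʳ i))
      sum-split zero    t = ≈ᴹ-sym (+ᴹ-identityˡ _)
      sum-split (suc p) t = ≈ᴹ-trans (+ᴹ-congˡ (sum-split p (t ∘ suc))) (≈ᴹ-sym (+ᴹ-assoc _ _ _))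

    Independent Spanning : ∀ {n} → Vector Carrierᴹ n → Set _
    Independent b = ∀ x → combination M x b ≈ᴹ 0ᴹ → ∀ i → x i ≈ 0#
    Spanning    b = ∀ y → ∃ λ x → combination M x b ≈ᴹ y

  Kⁿ : ∀ n → Module K c ℓ
  Kⁿ n = functionModule K (Fin n)

  K-dimension : HasDimension {K = K} ⟨module⟩ 1
  K-dimension = (λ _ → 1#) , record
    { independent = λ { x e zero → trans (sym (trans (+-identityʳ _) (*-identityʳ _))) e }
    ; spanning    = λ y → (λ _ → y) , trans (+-identityʳ _) (*-identityʳ _)
    }

  scaling-linear : ∀ {m ℓm} (M : Module K m ℓm) u → IsLinear ⟨module⟩ M (λ a → Module._*ₗ_ M a u)
  scaling-linear M u = record
    { ⟦⟧-cong = λ e → M.*ₗ-cong e M.≈ᴹ-refl ; +-homo = λ a b → M.*ₗ-distribʳ u a b ; *ₗ-homo = λ a b → M.*ₗ-assoc a b u }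
    where module M = Module M

  module _ {m ℓm n ℓn p ℓp} {M : Module K m ℓm} {N : Module K n ℓn} {P : Module K p ℓp}
    (ι₁ : Module.Carrierᴹ M → Module.Carrierᴹ P) (ι₂ : Module.Carrierᴹ N → Module.Carrierᴹ P)
    (ι₁-linear : IsLinear M P ι₁) (ι₂-linear : IsLinear N P ι₂) where

    private
      module M = Module M
      module N = Module N
      module ι₁ = IsLinear ι₁-linear
      module ι₂ = IsLinear ι₂-linear
    open Module P

    -- The two hypotheses say that M ⊕ N → P, (x, y) ↦ ι₁ x + ι₂ y, is an isomorphism, without
    -- forming the direct sum; so the images of the two bases together are a basis of P.
    HasDimension-⊕ : (∀ x y → ι₁ x +ᴹ ι₂ y ≈ᴹ 0ᴹ → x M.≈ᴹ M.0ᴹ × y N.≈ᴹ N.0ᴹ) →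
                     (∀ z → ∃₂ λ x y → ι₁ x +ᴹ ι₂ y ≈ᴹ z) →
                     ∀ {r s} → HasDimension M r → HasDimension N s → HasDimension P (r ℕ.+ s)
    HasDimension-⊕ kernel decompose {r} {s} (b , b-basis) (b′ , b′-basis) = (ι₁ ∘ b) ++ (ι₂ ∘ b′) , record
      { independent = λ x e i → independent x e i (splitAt r i) ≡.refl
      ; spanning    = λ z → spanning z (decompose z)
      }
      where
      module b = IsBasis b-basis
      module b′ = IsBasis b′-basis

      split : ∀ x → combination P x ((ι₁ ∘ b) ++ (ι₂ ∘ b′)) ≈ᴹ
                    ι₁ (combination M (λ i → x (i ↑ˡ s)) b) +ᴹ ι₂ (combination N (λ i → x (r ↑ʳ i)) b′)
      split x = ≈ᴹ-trans (combination-split P x (ι₁ ∘ b) (ι₂ ∘ b′)) (≈ᴹ-sym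
        (+ᴹ-cong (ι₁.combination-homo (λ i → x (i ↑ˡ s)) b) (ι₂.combination-homo (λ i → x (r ↑ʳ i)) b′)))

      independent : ∀ x → combination P x ((ι₁ ∘ b) ++ (ι₂ ∘ b′)) ≈ᴹ 0ᴹ → ∀ i j → splitAt r i ≡ j → x i ≈ 0#
      independent x e i (inj₁ j) eq = ≡.subst (λ i → x i ≈ 0#) (Finₚ.splitAt⁻¹-↑ˡ eq)
        (b.independent _ (proj₁ (kernel _ _ (≈ᴹ-trans (≈ᴹ-sym (split x)) e))) j)
      independent x e i (inj₂ j) eq = ≡.subst (λ i → x i ≈ 0#) (Finₚ.splitAt⁻¹-↑ʳ eq)
        (b′.independent _ (proj₂ (kernel _ _ (≈ᴹ-trans (≈ᴹ-sym (split x)) e))) j)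

      spanning : ∀ z → (∃₂ λ x y → ι₁ x +ᴹ ι₂ y ≈ᴹ z) → ∃ λ x → combination P x ((ι₁ ∘ b) ++ (ι₂ ∘ b′)) ≈ᴹ z
      spanning z (x , y , e) with b.spanning x | b′.spanning y
      ... | c , ec | c′ , ec′ = c ++ c′ , ≈ᴹ-trans (split (c ++ c′)) (≈ᴹ-trans
        (+ᴹ-cong
          (ι₁.⟦⟧-cong (M.≈ᴹ-trans (combination-cong M b λ i → reflexive (lookup-++ˡ c c′ i)) ec))
          (ι₂.⟦⟧-cong (N.≈ᴹ-trans (combination-cong N b′ λ i → reflexive (lookup-++ʳ c c′ i)) ec′)))
        e)

  module _ {m ℓm n ℓn} {M : Module K m ℓm} {N : Module K n ℓn} where

    private
      module M = Module M
      module N = Module N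

    HasDimension-≅ : ∀ {f} → IsLinear M N f →
                     (∀ x → f x N.≈ᴹ N.0ᴹ → x M.≈ᴹ M.0ᴹ) → (∀ y → ∃ λ x → f x N.≈ᴹ y) →
                     ∀ {r} → HasDimension M r → HasDimension N r
    HasDimension-≅ {f} f-linear kernel surjective (b , b-basis) = f ∘ b , record
      { independent = λ x e → b.independent x (kernel _ (N.≈ᴹ-trans (f.combination-homo x b) e))
      ; spanning    = λ y → let (x , fx≈y) = surjective y; (c , e) = b.spanning x in
          c , N.≈ᴹ-trans (N.≈ᴹ-sym (f.combination-homo c b)) (N.≈ᴹ-trans (f.⟦⟧-cong e) fx≈y)
      }
      where
      module b = IsBasis b-basis
      module f = IsLinear f-linear

  module _ {m ℓm} {M : Module K m ℓm} where

    open Module M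
    open GroupProperties +-group using () renaming (inverseˡ-unique to -‿unique; ⁻¹-involutive to -‿involutive)

    -- Independence makes the coefficients chosen by `spanning` unique, and uniqueness forces this
    -- choice to be linear.
    HasDimension⇒coordinates : ∀ {n} → HasDimension M n → ∃ λ φ → IsLinear M (Kⁿ n) φ ×
                               (∀ x → (∀ i → φ x i ≈ 0#) → x ≈ᴹ 0ᴹ)
    HasDimension⇒coordinates {n} (b , b-basis) = φ , record
      { ⟦⟧-cong = λ {x} {y} x≈y → unique (≈ᴹ-trans (φ-combination x) (≈ᴹ-trans x≈y (≈ᴹ-sym (φ-combination y))))
      ; +-homo  = λ x y → unique (≈ᴹ-trans (φ-combination (x +ᴹ y)) (≈ᴹ-sym (≈ᴹ-trans (combination-+ M (φ x) (φ y) b)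
          (+ᴹ-cong (φ-combination x) (φ-combination y)))))
      ; *ₗ-homo = λ a x → unique (≈ᴹ-trans (φ-combination (a *ₗ x)) (≈ᴹ-sym (≈ᴹ-trans (combination-* M a (φ x) b)
          (*ₗ-cong refl (φ-combination x)))))
      } , λ x e → ≈ᴹ-trans (≈ᴹ-sym (φ-combination x)) (combination-0 M (φ x) b e)
      where
      open IsBasis b-basis
      φ : Carrierᴹ → Vector Carrier n
      φ x = proj₁ (spanning x)

      φ-combination : ∀ x → combination M (φ x) b ≈ᴹ x
      φ-combination x = proj₂ (spanning x)

      unique : ∀ {x y} → combination M x b ≈ᴹ combination M y b → ∀ i → x i ≈ y i
      unique {x} {y} e i = trans (-‿unique _ _ (independent _ (begin
        combination M (λ i → x i + - 1# * y i) b                  ≈⟨ combination-+ M x (λ i → - 1# * y i) b ⟩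
        combination M x b +ᴹ combination M (λ i → - 1# * y i) b   ≈⟨ +ᴹ-cong e (combination-* M (- 1#) y b) ⟩
        combination M y b +ᴹ (- 1#) *ₗ combination M y b          ≈⟨ +ᴹ-congʳ (*ₗ-identityˡ _) ⟨
        1# *ₗ combination M y b +ᴹ (- 1#) *ₗ combination M y b    ≈⟨ *ₗ-distribʳ _ _ _ ⟨
        (1# + - 1#) *ₗ combination M y b                          ≈⟨ *ₗ-cong (-‿inverseʳ 1#) ≈ᴹ-refl ⟩
        0# *ₗ combination M y b                                   ≈⟨ *ₗ-zeroˡ _ ⟩
        0ᴹ                                                        ∎) i))
        (trans (-‿cong (-1*x≈-x (y i))) (-‿involutive (y i)))
        where
        open import Relation.Binary.Reasoning.Setoid ≈ᴹ-setoid
        open RingProperties ring using (-1*x≈-x)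

    component-linear : ∀ {n} {φ} → IsLinear M (Kⁿ n) φ → ∀ i → IsLinear M ⟨module⟩ (λ x → φ x i)
    component-linear φ-linear i = record
      { ⟦⟧-cong = λ e → φ.⟦⟧-cong e i ; +-homo = λ x y → φ.+-homo x y i ; *ₗ-homo = λ a x → φ.*ₗ-homo a x i }
      where module φ = IsLinear φ-linear

    module Kernel {ψ} (ψ-linear : IsLinear M ⟨module⟩ ψ) where

      open IsLinear ψ-linear

      kernel : Submodule M ℓ
      kernel = record
        { Member    = λ x → ψ x ≈ 0#
        ; resp      = λ e x∈ → trans (sym (⟦⟧-cong e)) x∈
        ; 0-closed  = 0-homo
        ; +-closed  = λ x∈ y∈ → trans (+-homo _ _) (trans (+-cong x∈ y∈) (+-identityʳ 0#))
        ; *ₗ-closed = λ a x∈ → trans (*ₗ-homo a _) (trans (*-congˡ x∈) (zeroʳ a))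
        }

      module Pivot (u : Carrierᴹ) (v : Carrier) (vψu≈1 : v * ψ u ≈ 1#) where

        open CommutativeSemigroupProperties (CommutativeMonoid.commutativeSemigroup +ᴹ-commutativeMonoid)
          using (interchange; x∙yz≈y∙xz)
        private module K = Module (submodule kernel)

        -- This is -ψ(x)/ψ(u): adding that multiple of `u` moves `x` into the kernel of `ψ`.
        coefficient : Carrierᴹ → Carrier
        coefficient x = - 1# * (ψ x * v)

        coefficient-ψu : ∀ x → ψ x + coefficient x * ψ u ≈ 0#
        coefficient-ψu x = begin
          ψ x + - 1# * (ψ x * v) * ψ u     ≈⟨ +-congˡ (*-assoc _ _ _) ⟩
          ψ x + - 1# * (ψ x * v * ψ u)     ≈⟨ +-congˡ (*-congˡ (trans (*-assoc _ _ _) (trans (*-congˡ vψu≈1) (*-identityʳ _)))) ⟩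
          ψ x + - 1# * ψ x                 ≈⟨ +-congˡ (-1*x≈-x _) ⟩
          ψ x + - ψ x                      ≈⟨ -‿inverseʳ _ ⟩
          0#                               ∎
          where
          open import Relation.Binary.Reasoning.Setoid setoid
          open RingProperties ring using (-1*x≈-x)

        π : Carrierᴹ → K.Carrierᴹ
        π x = x +ᴹ coefficient x *ₗ u , trans (+-homo _ _) (trans (+-congˡ (*ₗ-homo _ u)) (coefficient-ψu x))

        π-linear : IsLinear M (submodule kernel) π
        π-linear = record
          { ⟦⟧-cong = λ e → +ᴹ-cong e (*ₗ-cong (*-congˡ (*-congʳ (⟦⟧-cong e))) ≈ᴹ-refl)
          ; +-homo  = λ x y → ≈ᴹ-trans (+ᴹ-congˡ (≈ᴹ-trans
              (*ₗ-cong (trans (*-congˡ (trans (*-congʳ (+-homo x y)) (distribʳ v _ _))) (distribˡ _ _ _)) ≈ᴹ-refl)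
              (*ₗ-distribʳ u _ _))) (interchange x y _ _)
          ; *ₗ-homo = λ a x → ≈ᴹ-trans (+ᴹ-congˡ (≈ᴹ-trans
              (*ₗ-cong (trans (*-congˡ (trans (*-congʳ (*ₗ-homo a x)) (*-assoc a _ v))) (x*yz≈y*xz (- 1#) a _)) ≈ᴹ-refl)
              (*ₗ-assoc a _ u))) (≈ᴹ-sym (*ₗ-distribˡ a _ _))
          }
          where open CommutativeSemigroupProperties *-commutativeSemigroup using () renaming (x∙yz≈y∙xz to x*yz≈y*xz)

        -- M is the direct sum of the line through `u` and the kernel. `π` supplies the kernel
        -- component, and applying `ψ` to a u + y = 0 gives a ψ(u) = 0, hence a = 0.
        HasDimension-pivot : ∀ {r} → HasDimension (submodule kernel) r → HasDimension M (suc r)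
        HasDimension-pivot = HasDimension-⊕ {M = ⟨module⟩} {submodule kernel} {M}
          (_*ₗ u) proj₁ (scaling-linear M u) (inclusion-linear kernel)
          (λ { a (y , ψy≈0) e → let a≈0 = scalar-zero ψy≈0 e in
               a≈0 , ≈ᴹ-trans (≈ᴹ-sym (≈ᴹ-trans (+ᴹ-congʳ (≈ᴹ-trans (*ₗ-cong a≈0 ≈ᴹ-refl) (*ₗ-zeroˡ u))) (+ᴹ-identityˡ y))) e })
          (λ z → ψ z * v , π z , ≈ᴹ-trans (x∙yz≈y∙xz _ z _) (≈ᴹ-trans (+ᴹ-congˡ (≈ᴹ-trans (≈ᴹ-sym (*ₗ-distribʳ u _ _))
            (≈ᴹ-trans (*ₗ-cong (trans (+-congˡ (-1*x≈-x _)) (-‿inverseʳ _)) ≈ᴹ-refl) (*ₗ-zeroˡ u)))) (+ᴹ-identityʳ z)))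
          K-dimension
          where
          open import Relation.Binary.Reasoning.Setoid setoid
          open RingProperties ring using (-1*x≈-x)
          ψu-regular : ∀ {a} → a * ψ u ≈ 0# → a ≈ 0#
          ψu-regular {a} e = begin
            a               ≈⟨ *-identityˡ a ⟨
            1# * a          ≈⟨ *-congʳ vψu≈1 ⟨
            v * ψ u * a     ≈⟨ *-assoc v _ a ⟩
            v * (ψ u * a)   ≈⟨ *-congˡ (trans (*-comm _ a) e) ⟩
            v * 0#          ≈⟨ zeroʳ v ⟩
            0#              ∎

          scalar-zero : ∀ {a y} → ψ y ≈ 0# → a *ₗ u +ᴹ y ≈ᴹ 0ᴹ → a ≈ 0#
          scalar-zero {a} {y} ψy≈0 e = ψu-regular (begin
            a * ψ u             ≈⟨ *ₗ-homo a u ⟨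
            ψ (a *ₗ u)          ≈⟨ +-identityʳ _ ⟨
            ψ (a *ₗ u) + 0#     ≈⟨ +-congˡ ψy≈0 ⟨
            ψ (a *ₗ u) + ψ y    ≈⟨ +-homo _ _ ⟨
            ψ (a *ₗ u +ᴹ y)     ≈⟨ ⟦⟧-cong e ⟩
            ψ 0ᴹ                ≈⟨ 0-homo ⟩
            0#                  ∎)

module HeytingDimension {c ℓ₁ ℓ₂} (k : HeytingField c ℓ₁ ℓ₂) where

  open HeytingField k using (_#_; tight; #⇒invertible; #-irrefl)
  K : CommutativeRing c ℓ₁
  K = HeytingCommutativeRing.commutativeRing (HeytingField.heytingCommutativeRing k)

  open HeytingProperties (HeytingField.heytingCommutativeRing k) using (x-0≈x; 1#0)
  open CommutativeRing K hiding (zero)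
  open LinearMaps {K = K}

  inverse : ∀ {x} → x # 0# → ∃ λ y → y * x ≈ 1#
  inverse x#0 with #⇒invertible x#0
  ... | y , e , _ = y , trans (*-congˡ (sym (x-0≈x _))) e

  ¬#0⇒≈0 : ∀ {x} → ¬ (x # 0#) → x ≈ 0#
  ¬#0⇒≈0 = proj₁ (tight _ _)

  -- Gaussian elimination on the first coordinate. If it vanishes on all the vectors, they lie in
  -- its kernel; otherwise one vector is a pivot and the others are projected into the kernel. The
  -- kernel embeds by the remaining coordinates.
  independent⇒≤ : ∀ n {m ℓm} {M : Module K m ℓm} (let open Module M) {φ} → IsLinear M (Kⁿ n) φ →
                  (∀ x → (∀ i → φ x i ≈ 0#) → x ≈ᴹ 0ᴹ) →
                  ∀ {r} (u : Vector Carrierᴹ r) → Independent M u → r ℕ.≤ n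
  independent⇒≤ n       φ-linear φ-injective {zero}  u u-independent = z≤n
  independent⇒≤ zero    {M = M} φ-linear φ-injective {suc r} u u-independent =
    -- Nothing is left to detect a nonzero vector, so even the combination with all coefficients 1
    -- vanishes.
    contradiction (u-independent (λ _ → 1#) (φ-injective _ λ ()) 0F) λ 1≈0 → #-irrefl 1≈0 1#0
  independent⇒≤ (suc n) {M = M} {φ} φ-linear φ-injective {suc r} u u-independent =
    -- Whether a pivot exists is undecidable, but the inequality is decidable, so the case
    -- distinction may be made under double negation.
    decidable-stable (suc r ℕₚ.≤? suc n) (¬¬-map cases ¬¬-excluded-middle)
    where
    open Module M
    open Kernel (component-linear φ-linear 0F)
    module φ = IsLinear φ-linear

    tail-linear : IsLinear (submodule kernel) (Kⁿ n) (λ x i → φ (proj₁ x) (suc i))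
    tail-linear = record
      { ⟦⟧-cong = λ e i → φ.⟦⟧-cong e (suc i)
      ; +-homo  = λ x y i → φ.+-homo (proj₁ x) (proj₁ y) (suc i)
      ; *ₗ-homo = λ a x i → φ.*ₗ-homo a (proj₁ x) (suc i)
      }

    tail-injective : ∀ x → (∀ i → φ (proj₁ x) (suc i) ≈ 0#) → proj₁ x ≈ᴹ 0ᴹ
    tail-injective (x , x∈) e = φ-injective x λ { zero → x∈ ; (suc i) → e i }

    cases : Dec (∃ λ i → φ (u i) 0F # 0#) → suc r ℕ.≤ suc n
    cases (no ¬p) = ℕₚ.m≤n⇒m≤1+n (independent⇒≤ n tail-linear tail-injective u′
      λ x e → u-independent x (≈ᴹ-trans
        (≈ᴹ-sym (IsLinear.combination-homo (inclusion-linear kernel) x u′)) e))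
      where
      u′ : Vector (∃ (Member kernel)) (suc r)
      u′ i = u i , ¬#0⇒≈0 λ p → ¬p (i , p)
    -- A relation among the projected vectors is, by linearity of `π`, one among the original
    -- vectors with `coefficient z` inserted at the pivot.
    cases (yes (i , p)) = s≤s (independent⇒≤ n tail-linear tail-injective (π ∘ removeAt u i) λ x e j →
      let z = combination M x (removeAt u i)
          x̂ = insertAt x i (coefficient z)
      in trans (reflexive (≡.sym (insertAt-punchIn x i (coefficient z) j))) (u-independent x̂
        (≈ᴹ-trans (combination-remove M i x̂ u) (≈ᴹ-trans
          (+ᴹ-cong (*ₗ-cong (reflexive (insertAt-lookup x i _)) ≈ᴹ-refl)
            (combination-cong M _ λ j → reflexive (insertAt-punchIn x i _ j)))
          (≈ᴹ-trans (+ᴹ-comm _ _) (≈ᴹ-trans (IsLinear.combination-homo π-linear x (removeAt u i)) e))))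
        (punchIn i j)))
      where open Pivot (u i) (proj₁ (inverse p)) (proj₂ (inverse p))

  dimension-unique : ∀ {m ℓm} {M : Module K m ℓm} {r s} → HasDimension M r → HasDimension M s → r ≡ s
  dimension-unique {M = M} p q = ℕₚ.≤-antisym (dimension-≤ p q) (dimension-≤ q p)
    where
    dimension-≤ : ∀ {r s} → HasDimension M r → HasDimension M s → r ℕ.≤ s
    dimension-≤ {s = s} (b , b-basis) q with HasDimension⇒coordinates q
    ... | φ , φ-linear , φ-injective = independent⇒≤ s φ-linear φ-injective b (IsBasis.independent b-basis)

  -- Either the first coordinate vanishes on all of M and the others already embed it, or some
  -- vector is a pivot and M is a line plus the kernel.
  embedded⇒¬¬dimension : ∀ n {m ℓm} {M : Module K m ℓm} (let open Module M) {φ} → IsLinear M (Kⁿ n) φ →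
                         (∀ x → (∀ i → φ x i ≈ 0#) → x ≈ᴹ 0ᴹ) → ¬ ¬ ∃ (HasDimension M)
  embedded⇒¬¬dimension zero    {M = M} φ-linear φ-injective ¬∃ = ¬∃ (0 , (λ ()) , record
    { independent = λ _ _ () ; spanning = λ x → (λ ()) , Module.≈ᴹ-sym M (φ-injective x λ ()) })
  embedded⇒¬¬dimension (suc n) {M = M} {φ} φ-linear φ-injective ¬∃ =
    ¬¬-excluded-middle {A = ∃ λ x → φ x 0F # 0#} λ where
      (no ¬p) → embedded⇒¬¬dimension n {M = M}
        (record { ⟦⟧-cong = λ e i → φ.⟦⟧-cong e (suc i)
                ; +-homo = λ x y i → φ.+-homo x y (suc i)
                ; *ₗ-homo = λ a x i → φ.*ₗ-homo a x (suc i) })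
        (λ x e → φ-injective x λ { zero → ¬#0⇒≈0 λ p → ¬p (x , p) ; (suc i) → e i }) ¬∃
      (yes (u , p)) → let open Kernel (component-linear φ-linear 0F)
                          open Pivot u (proj₁ (inverse p)) (proj₂ (inverse p)) in
        embedded⇒¬¬dimension n {M = submodule kernel}
          (record { ⟦⟧-cong = λ e i → φ.⟦⟧-cong e (suc i)
                  ; +-homo = λ x y i → φ.+-homo (proj₁ x) (proj₁ y) (suc i)
                  ; *ₗ-homo = λ a x i → φ.*ₗ-homo a (proj₁ x) (suc i) })
          (λ { (x , x∈) e → φ-injective x λ { zero → x∈ ; (suc i) → e i } })
          λ { (r , d) → ¬∃ (suc r , HasDimension-pivot d) }
    where module φ = IsLinear φ-linear

  submodule-dimension : ∀ {m ℓm p n} {M : Module K m ℓm} (N : Submodule M p) → HasDimension M n →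
                        ¬ ¬ ∃ (HasDimension (submodule N))
  submodule-dimension {n = n} {M} N d with HasDimension⇒coordinates d
  ... | φ , φ-linear , φ-injective = embedded⇒¬¬dimension n {M = submodule N} {λ x → φ (proj₁ x)}
    (record { ⟦⟧-cong = φ.⟦⟧-cong
            ; +-homo = λ x y → φ.+-homo (proj₁ x) (proj₁ y)
            ; *ₗ-homo = λ a x → φ.*ₗ-homo a (proj₁ x) })
    (λ x → φ-injective (proj₁ x))
    where module φ = IsLinear φ-linear

  -- A relation with a coefficient apart from 0 makes the corresponding generator redundant; if
  -- there is none, tightness of apartness makes the family independent.
  spanning⇒¬¬dimension : ∀ n {m ℓm} {M : Module K m ℓm} (b : Vector (Module.Carrierᴹ M) n) → Spanning M b →
                         ¬ ¬ ∃ (HasDimension M)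
  spanning⇒¬¬dimension zero    b b-spanning ¬∃ = ¬∃ (0 , b , record { independent = λ _ _ () ; spanning = b-spanning })
  spanning⇒¬¬dimension (suc n) {M = M} b b-spanning ¬∃ =
    ¬¬-excluded-middle {A = ∃ λ x → combination M x b ≈ᴹ 0ᴹ × ∃ λ i → x i # 0#} λ where
      (no ¬p) → ¬∃ (suc n , b , record
        { independent = λ x e i → ¬#0⇒≈0 λ p → ¬p (x , e , i , p) ; spanning = b-spanning })
      (yes (x , e , i , p)) → let (v , vx≈1) = inverse p in
        spanning⇒¬¬dimension n {M = M} (removeAt b i) (λ y →
          let (w , w≈y) = b-spanning y
              -- `t` is minus `w i` divided by `x i`, so adding `t` times the relation cancels the
              -- coefficient of the removed generator.
              t = - 1# * (w i * v)
          in removeAt (λ j → w j + t * x j) i , (begin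
            combination M (removeAt (λ j → w j + t * x j) i) (removeAt b i)
              ≈⟨ +ᴹ-identityˡ _ ⟨
            0ᴹ +ᴹ combination M (removeAt (λ j → w j + t * x j) i) (removeAt b i)
              ≈⟨ +ᴹ-congʳ (≈ᴹ-trans (*ₗ-cong (eliminate (w i) v (x i) vx≈1) ≈ᴹ-refl) (*ₗ-zeroˡ (b i))) ⟨
            (w i + t * x i) *ₗ b i +ᴹ combination M (removeAt (λ j → w j + t * x j) i) (removeAt b i)
              ≈⟨ combination-remove M i (λ j → w j + t * x j) b ⟨
            combination M (λ j → w j + t * x j) b
              ≈⟨ combination-+ M w (λ j → t * x j) b ⟩
            combination M w b +ᴹ combination M (λ j → t * x j) b
              ≈⟨ +ᴹ-cong w≈y (≈ᴹ-trans (combination-* M t x b) (≈ᴹ-trans (*ₗ-cong refl e) (*ₗ-zeroʳ t))) ⟩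
            y +ᴹ 0ᴹ
              ≈⟨ +ᴹ-identityʳ y ⟩
            y ∎)) ¬∃
    where
    open Module M
    open import Relation.Binary.Reasoning.Setoid ≈ᴹ-setoid
    eliminate : ∀ w v x → v * x ≈ 1# → w + - 1# * (w * v) * x ≈ 0#
    eliminate w v x e = trans (+-congˡ (trans (*-assoc _ _ _) (trans (-1*x≈-x _)
      (-‿cong (trans (*-assoc _ _ _) (trans (*-congˡ e) (*-identityʳ w))))))) (-‿inverseʳ w)
      where open RingProperties ring using (-1*x≈-x)

-- Splines on planar trees

restrictSubmodule : ∀ {a ℓa b ℓb m ℓm p} {A : CommutativeRing a ℓa} {B : CommutativeRing b ℓb} {M : Module B m ℓm} →
  (σ : RingHomomorphism (CommutativeRing.rawRing A) (CommutativeRing.rawRing B)) →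
  Submodule M p → Submodule (restrictScalars {A = A} σ M) p
restrictSubmodule σ N = record
  { Member    = N.Member
  ; resp      = N.resp
  ; 0-closed  = N.0-closed
  ; +-closed  = N.+-closed
  ; *ₗ-closed = λ a → N.*ₗ-closed (RingHomomorphism.⟦_⟧ σ a)
  }
  where module N = Submodule N

module SplineDimensions {a ℓa r ℓr p} {K : CommutativeRing a ℓa} (R : CommutativeRing r ℓr)
  (σ : RingHomomorphism (CommutativeRing.rawRing K) (CommutativeRing.rawRing R)) {L : Set} (α : L → Ideal R p) where

  open CommutativeRing R hiding (zero)
  open Differences R
  open LinearMaps {K = K}
  open AbelianGroupProperties +-abelianGroup using (//-rightDividesˡ)
  open RingHomomorphism σ using (⟦_⟧)

  private
    x-x∈ : ∀ (I : Ideal R p) x → Member I (x - x)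
    x-x∈ I x = Submodule.resp I (0-difference refl) (Submodule.0-closed I)

  ideal : Ideal R p → Module K (r ⊔ p) ℓr
  ideal J = submodule (restrictSubmodule {A = K} σ J)

  -- The root condition makes the induction close: `J` is the unit ideal for the whole tree and the
  -- label of the joining edge for a branch.
  rootedSplines : Ideal R p → (t : Tree L) → Submodule (functionModule R (Vertex t)) p
  rootedSplines J t = record
    { Member    = λ f → Member (splines R α t) f × Member J (f (rootOf t))
    ; resp      = λ e (f∈ , j) → S.resp e f∈ , J.resp (e _) j
    ; 0-closed  = S.0-closed , J.0-closed
    ; +-closed  = λ {f} {g} (f∈ , j) (g∈ , j′) → S.+-closed {f} {g} f∈ g∈ , J.+-closed j j′
    ; *ₗ-closed = λ b {f} (f∈ , j) → S.*ₗ-closed b {f} f∈ , J.*ₗ-closed b j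
    }
    where
    module J = Submodule J
    module S = Submodule (splines R α t)

  RootedSplines : Ideal R p → Tree L → Module K (r ⊔ p) ℓr
  RootedSplines J t = submodule (restrictSubmodule {A = K} σ (rootedSplines J t))

  rooted-leaf : ∀ J {m} → HasDimension (ideal J) m → HasDimension (RootedSplines J (node [])) m
  rooted-leaf J = HasDimension-≅ {M = ideal J} {RootedSplines J (node [])}
    {λ (x , x∈) → (λ _ → x) , (λ { (stem ()) ; (below () _) }) , x∈}
    (record { ⟦⟧-cong = λ e _ → e ; +-homo = λ _ _ _ → refl ; *ₗ-homo = λ _ _ _ → refl })
    (λ _ e → e root)
    λ (f , _ , f∈) → (f root , f∈) , λ { root → refl ; (below () _) }

  module _ (J : Ideal R p) (l : L) (t : Tree L) (bs : List (L × Tree L)) where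

    private
      T = node ((l , t) ∷ bs)
      module J = Submodule J
      module αl = Submodule (α l)

      Values : Tree L → Set r
      Values t = Vertex t → Carrier

      -- A spline is a spline on the rest of the tree, continued by its root value along the first
      -- branch, plus a spline on that branch, continued by zero.
      ι₁ : Values (node bs) → Values T
      ι₁ f root              = f root
      ι₁ f (below zero v)    = f root
      ι₁ f (below (suc i) v) = f (below i v)

      ι₂ : Values t → Values T
      ι₂ h root              = 0#
      ι₂ h (below zero v)    = h v
      ι₂ h (below (suc i) v) = 0#

      ι₁-spline : ∀ {f} → Member (splines R α (node bs)) f → Member (splines R α T) (ι₁ f)
      ι₁-spline f∈ (stem zero)       = x-x∈ (α l) _
      ι₁-spline f∈ (stem (suc i))    = f∈ (stem i)
      ι₁-spline f∈ (below zero e)    = x-x∈ (α (label e)) _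
      ι₁-spline f∈ (below (suc i) e) = f∈ (below i e)

      ι₂-spline : ∀ {h} → Member (splines R α t) h → Member (α l) (h (rootOf t)) → Member (splines R α T) (ι₂ h)
      ι₂-spline h∈ j (stem zero)       = αl.resp (sym (+-identityˡ _)) (αl.-ᴹ-closed j)
      ι₂-spline h∈ j e@(stem (suc i))  = x-x∈ (α (label e)) 0#
      ι₂-spline h∈ j (below zero e)    = h∈ e
      ι₂-spline h∈ j (below (suc i) e) = x-x∈ (α (label e)) 0#

      branch : Values T → Values t
      branch z v = z (below zero v) - z root

      rest : Values T → Values (node bs)
      rest z root        = z root
      rest z (below i v) = z (below (suc i) v)

      rest-spline : ∀ {z} → Member (splines R α T) z → Member (splines R α (node bs)) (rest z)
      rest-spline z∈ (stem i)    = z∈ (stem (suc i))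
      rest-spline z∈ (below i e) = z∈ (below (suc i) e)

      -- Subtracting the constant `z root` changes no difference along an edge of the branch.
      branch-spline : ∀ {z} → Member (splines R α T) z → Member (splines R α t) (branch z)
      branch-spline {z} z∈ e = Submodule.resp (α (label e)) (sym (difference-cancel _ _ _)) (z∈ (below zero e))
        where
        difference-cancel : ∀ x y w → (x - w) - (y - w) ≈ x - y
        difference-cancel x y w = trans (+-congˡ (swap-difference y w)) (trans-difference x w y)

    -- `rest` and `branch` together invert (f, h) ↦ ι₁ f + ι₂ h. The condition on the first stem is
    -- exactly what puts the root value of `branch z` into `α l`.
    rooted-branch : ∀ {m n} → HasDimension (RootedSplines J (node bs)) m → HasDimension (RootedSplines (α l) t) n →
                    HasDimension (RootedSplines J T) (m ℕ.+ n)
    rooted-branch = HasDimension-⊕ {M = RootedSplines J (node bs)} {RootedSplines (α l) t} {RootedSplines J T}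
      (λ (f , f∈ , j) → ι₁ f , ι₁-spline f∈ , j)
      (λ (h , h∈ , j) → ι₂ h , ι₂-spline h∈ j , J.0-closed)
      (record
        { ⟦⟧-cong = λ { e root → e root ; e (below zero v) → e root ; e (below (suc i) v) → e (below i v) }
        ; +-homo  = λ { _ _ root → refl ; _ _ (below zero v) → refl ; _ _ (below (suc i) v) → refl }
        ; *ₗ-homo = λ { _ _ root → refl ; _ _ (below zero v) → refl ; _ _ (below (suc i) v) → refl }
        })
      (record
        { ⟦⟧-cong = λ { e root → refl ; e (below zero v) → e v ; e (below (suc i) v) → refl }
        ; +-homo  = λ { _ _ root → sym (+-identityʳ 0#) ; _ _ (below zero v) → refl
                      ; _ _ (below (suc i) v) → sym (+-identityʳ 0#) }
        ; *ₗ-homo = λ { _ _ root → sym (zeroʳ _) ; _ _ (below zero v) → refl ; _ _ (below (suc i) v) → sym (zeroʳ _) }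
        })
      (λ _ _ e → (λ { root → trans (sym (+-identityʳ _)) (e root)
                    ; (below i v) → trans (sym (+-identityʳ _)) (e (below (suc i) v)) })
               , λ v → trans (sym (+-identityˡ _)) (trans (+-congʳ (trans (sym (e root)) (+-identityʳ _))) (e (below zero v))))
      (λ (z , z∈ , j) → (rest z , rest-spline z∈ , j)
        -- The stem condition has the upper value minus the lower one, the root value of `branch z`
        -- is the opposite difference.
        , (branch z , branch-spline {z} z∈ , αl.resp (swap-difference _ _) (αl.-ᴹ-closed (z∈ (stem zero))))
        , λ { root → +-identityʳ _
            ; (below zero v) → trans (+-comm _ _) (//-rightDividesˡ (z root) (z (below zero v)))
            ; (below (suc i) v) → +-identityʳ _ })

  module _ {D : L → ℕ} (α-dimension : ∀ l → HasDimension (ideal (α l)) (D l)) where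

    -- What follows the first return hangs from the same root and keeps `J`; the inner word restarts
    -- with the ideal `α l`, whose dimension is the contribution of its edge.
    rootedSplines-dimension : ∀ J {m} → HasDimension (ideal J) m → ∀ {w} (q : Dyck w) →
                              HasDimension (RootedSplines J (node (branches q))) (m ℕ.+ edgeWeight D q)
    rootedSplines-dimension J {m} d ε = ≡.subst (HasDimension _) (≡.sym (ℕₚ.+-identityʳ m)) (rooted-leaf J d)
    rootedSplines-dimension J {m} d (wrap l q₁ q₂) = ≡.subst (HasDimension _)
      (≡.trans (ℕₚ.+-assoc m (edgeWeight D q₂) (D l ℕ.+ edgeWeight D q₁))
        (≡.cong (m ℕ.+_) (≡.trans
          (ℕₚ.+-comm (edgeWeight D q₂) (D l ℕ.+ edgeWeight D q₁)) (ℕₚ.+-assoc (D l) (edgeWeight D q₁) (edgeWeight D q₂)))))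
      (rooted-branch J l (node (branches q₁)) (branches q₂)
        (rootedSplines-dimension J d q₂) (rootedSplines-dimension (α l) (α-dimension l) q₁))

    splines-dimension : ∀ {m} → HasDimension (restrictScalars {A = K} σ (⟨module⟩ {R = R})) m → ∀ (w : DyckWord L) →
                        HasDimension (restrictScalars {A = K} σ (Spl R α (treeOf w))) (m ℕ.+ edgeWeight D (proj₂ w))
    splines-dimension d w@(_ , q) = HasDimension-≅ {M = RootedSplines (unitIdeal R) (treeOf w)} {f = λ (f , f∈ , _) → f , f∈}
      (record { ⟦⟧-cong = λ e → e ; +-homo = λ _ _ _ → refl ; *ₗ-homo = λ _ _ _ → refl })
      (λ _ e → e)
      (λ (f , f∈) → (f , f∈ , lift tt) , λ _ → refl)
      (rootedSplines-dimension (unitIdeal R)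
        (HasDimension-≅ {N = ideal (unitIdeal R)} {f = λ x → x , lift tt}
          (record { ⟦⟧-cong = λ e → e ; +-homo = λ _ _ → refl ; *ₗ-homo = λ _ _ → refl })
          (λ _ e → e) (λ (x , _) → x , refl) d) q)

-- Truncated polynomials are finitely spanned

module TruncatedSpan {c ℓ} (A : CommutativeRing c ℓ) (n : ℕ) where

  open MultiPoly A
  private module A = CommutativeRing A
  P : CommutativeRing c ℓ
  P = polynomials n
  open CommutativeRing P hiding (zero)
  open Differences P
  open LinearMaps {K = A}

  P-module : Module A c ℓ
  P-module = restrictScalars {A = A} (constants n) (⟨module⟩ {R = P})

  private module M = Module P-module

  -- `S` may be any set, and its elements need only be reached modulo `I`; thus constants and
  -- multiples of single variables can be spanned separately and then added.
  record FinitelySpanned {i p} (I : Ideal P i) (S : Pred Carrier p) : Set (c ⊔ i ⊔ p) where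
    field
      {count} : ℕ
      family : Vector Carrier count
      spans  : ∀ {y} → S y → ∃ λ x → Member I (combination P-module x family - y)

  open FinitelySpanned

  module _ {i} (I : Ideal P i) where

    private module I = Submodule I

    constants-spanned : FinitelySpanned I (λ y → ∃ λ a → y ≈ RingHomomorphism.⟦_⟧ (constants n) a)
    constants-spanned .count = 1
    constants-spanned .family _ = 1#
    constants-spanned .spans (a , e) =
      (λ _ → a) , I.resp (0-difference (trans (+-identityʳ _) (trans (*-identityʳ _) (sym e)))) I.0-closed

    +-spanned : ∀ {p q} {S : Pred Carrier p} {T : Pred Carrier q} → FinitelySpanned I S → FinitelySpanned I T →
                FinitelySpanned I (λ y → ∃₂ λ u v → y ≈ u + v × S u × T v)
    +-spanned b b′ .count = b .count ℕ.+ b′ .count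
    +-spanned b b′ .family = b .family ++ b′ .family
    +-spanned b b′ .spans (u , v , e , u∈ , v∈) with b .spans u∈ | b′ .spans v∈
    ... | x , x∈ | x′ , x′∈ = x ++ x′ , I.resp (trans (+-difference _ _ _ _) (+-cong
      (sym (trans (combination-split P-module (x ++ x′) (b .family) (b′ .family)) (+-cong
        (combination-cong P-module (b .family) λ i → A.reflexive (lookup-++ˡ x x′ i))
        (combination-cong P-module (b′ .family) λ i → A.reflexive (lookup-++ʳ x x′ i)))))
      (-‿cong (sym e)))) (I.+-closed x∈ x′∈)

  -- If the family reaches g modulo I, then z times the family reaches z g with an error in z I,
  -- which lies in J.
  multiples-spanned : ∀ {i j} {I : Ideal P i} {J : Ideal P j} z → (∀ {y} → Member I y → Member J (z * y)) →
                      FinitelySpanned I (λ _ → ⊤) → FinitelySpanned J (λ y → ∃ λ g → y ≈ z * g)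
  multiples-spanned z zI⊆J b .count = b .count
  multiples-spanned z zI⊆J b .family i = z * b .family i
  multiples-spanned {J = J} z zI⊆J b .spans (g , e) with b .spans {g} tt
  ... | x , x∈ = x , Submodule.resp J
    (trans (*-difference _ _ _) (+-cong (z*.combination-homo x (b .family)) (-‿cong (sym e)))) (zI⊆J x∈)
    where
    open CommutativeSemigroupProperties *-commutativeSemigroup using () renaming (x∙yz≈y∙xz to x*yz≈y*xz)
    multiplication-linear : IsLinear P-module P-module (z *_)
    multiplication-linear = record
      { ⟦⟧-cong = *-congˡ ; +-homo = distribˡ z ; *ₗ-homo = λ a y → x*yz≈y*xz z _ y }
    module z* = IsLinear multiplication-linear

  -- A constant plus a sum of multiples of the entries of `z`, nested so that spanning families can
  -- be built one entry at a time.
  Decomposable : ∀ {j} → Vector Carrier j → Pred Carrier (c ⊔ ℓ)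
  Decomposable {zero}  z y = ∃ λ a → y ≈ RingHomomorphism.⟦_⟧ (constants n) a
  Decomposable {suc j} z y = ∃₂ λ g v → y ≈ z zero * g + v × Decomposable (z ∘ suc) v

  decomposable-spanned : ∀ {i} {I J : Ideal P i} {j} (z : Vector Carrier j) →
                         (∀ l {y} → Member I y → Member J (z l * y)) →
                         FinitelySpanned I (λ _ → ⊤) → FinitelySpanned J (Decomposable z)
  decomposable-spanned {J = J} {zero}  z zI⊆J b = constants-spanned J
  decomposable-spanned {I = I} {J} {suc j} z zI⊆J b = record
    { family = sum-spanned .family
    ; spans  = λ (g , v , e , v∈) → sum-spanned .spans (z zero * g , v , e , (g , refl) , v∈)
    }
    where
    sum-spanned : FinitelySpanned J (λ y → ∃₂ λ u v → y ≈ u + v × (∃ λ g → u ≈ z zero * g) × Decomposable (z ∘ suc) v)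
    sum-spanned = +-spanned J (multiples-spanned {I = I} {J} (z zero) (zI⊆J zero) b)
      (decomposable-spanned {I = I} {J} (z ∘ suc) (zI⊆J ∘ suc) b)

module Decompositions {c ℓ} (A : CommutativeRing c ℓ) where

  open MultiPoly A
  open TruncatedSpan A using (Decomposable)

  module _ (n : ℕ) where

    private
      module P = CommutativeRing (polynomials n)
      module P′ = CommutativeRing (polynomials (suc n))
    open Poly (polynomials n) using (constant; indeterminate; constantHomomorphism; coeff; coeff-+; at)
    open FormalSeries (polynomials n) using (coeff-*; indeterminate-*ˢ)
    open RingHomomorphism constantHomomorphism

    constant-decomposable : ∀ {j} (z : Vector P.Carrier j) {y} → Decomposable n z y →
                            Decomposable (suc n) (constant ∘ z) (constant y)
    constant-decomposable {zero}  z (a , e)         = a , ⟦⟧-cong e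
    constant-decomposable {suc j} z (g , v , e , d) = constant g , constant v ,
      P′.trans (⟦⟧-cong e) (P′.trans (+-homo (z zero P.* g) v) (P′.+-congʳ {x = constant v} (*-homo (z zero) g))) ,
      constant-decomposable (z ∘ suc) d

    ∷-decomposition : ∀ a p → (a ∷ p) P′.≈ indeterminate P′.* p P′.+ constant a
    ∷-decomposition a p .at i = P.sym (P.trans (coeff-+ (indeterminate P′.* p) (constant a) i)
      (P.trans (P.+-congʳ (P.trans (coeff-* indeterminate p i) (indeterminate-*ˢ (coeff p) i))) (shifted i)))
      where
      shifted : ∀ i → FormalSeries.shift (polynomials n) (coeff p) i P.+ coeff (constant a) i P.≈ coeff (a ∷ p) i
      shifted zero    = P.+-identityˡ a
      shifted (suc i) = P.+-identityʳ _

    []≈0∷[] : [] P′.≈ (P.0# ∷ [])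
    []≈0∷[] .at zero    = P.refl
    []≈0∷[] .at (suc i) = P.refl

  -- The outermost variable takes everything above the constant term, which is a polynomial in the
  -- other variables and is decomposed in turn.
  variables-decomposable : ∀ n y → Decomposable n (variables n) y
  variables-decomposable zero    y       = y , CommutativeRing.refl (polynomials zero)
  variables-decomposable (suc n) []      = [] , constant 0# ,
    CommutativeRing.trans (polynomials (suc n)) ([]≈0∷[] n) (∷-decomposition n 0# []) ,
    constant-decomposable n (variables n) (variables-decomposable n 0#)
    where
    open CommutativeRing (polynomials n) using (0#)
    open Poly (polynomials n) using (constant)
  variables-decomposable (suc n) (a ∷ p) = p , Poly.constant (polynomials n) a , ∷-decomposition n a p ,
    constant-decomposable n (variables n) (variables-decomposable n a)

module _ {c ℓ₁ ℓ₂} (k : HeytingField c ℓ₁ ℓ₂) (n : ℕ) where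

  private
    -- The scalars and the maximal ideal are the same for every exponent; fixing it at 0 keeps the
    -- induction on `d` over one polynomial ring.
    K = scalars k n 0
  open TruncatedSpan K n using (P; FinitelySpanned; Decomposable; decomposable-spanned)
  open FinitelySpanned

  -- Every polynomial is a constant plus a sum of x_i g_i, and g_i matters only modulo 𝔪^d because
  -- x_i 𝔪^d lies in 𝔪^(d+1). For d = 0 the power is the unit ideal and the empty family suffices.
  polynomials-spanned : ∀ d → FinitelySpanned (idealPower P (maximalIdeal k n 0) d) (λ _ → ⊤)
  polynomials-spanned zero    = record { count = 0 ; family = λ () ; spans = λ _ → (λ ()) , lift tt }
  polynomials-spanned (suc d) = record
    { family = decomposable .family
    ; spans  = λ {y} _ → decomposable .spans (Decompositions.variables-decomposable K n y)
    }
    where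
    decomposable : FinitelySpanned (idealPower P (maximalIdeal k n 0) (suc d)) (Decomposable (MultiPoly.variables K n))
    decomposable = decomposable-spanned
      {I = idealPower P (maximalIdeal k n 0) d} {J = idealPower P (maximalIdeal k n 0) (suc d)}
      (MultiPoly.variables K n) (λ l y∈ → gen (product (gen (l , ≡.refl)) y∈)) (polynomials-spanned d)

  truncatedPolynomials-dimension : ∀ d →
    ¬ ¬ ∃ (HasDimension (restrictScalars {A = K} (structureMap k n d) (⟨module⟩ {R = truncatedPolynomials k n d})))
  truncatedPolynomials-dimension d = HeytingDimension.spanning⇒¬¬dimension k _ (polynomials-spanned d .family)
    λ y → let (x , x∈) = polynomials-spanned d .spans {y} tt in x , Quotient.congruent x∈

-- Dimensions of spline modules up to double negation, and the conclusion

¬¬-∀ : ∀ {a n} {P : Fin n → Set a} → (∀ i → ¬ ¬ P i) → ¬ ¬ (∀ i → P i)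
¬¬-∀ = Finₚ.sequence (RawMonad.rawApplicative ¬¬-Monad)

edgeWeight-cong : ∀ {L} {a b : L → ℕ} → (∀ l → a l ≡ b l) →
                  ∀ {w : List (Paren L)} (p : Dyck w) → edgeWeight a p ≡ edgeWeight b p
edgeWeight-cong e ε            = ≡.refl
edgeWeight-cong e (wrap l p q) = ≡.cong₂ ℕ._+_ (e l) (≡.cong₂ ℕ._+_ (edgeWeight-cong e p) (edgeWeight-cong e q))

emptyWord : ∀ {L} → DyckWord L
emptyWord = [] , ε

singleEdge : ∀ {L} → L → DyckWord L
singleEdge l = parenthesise l emptyWord emptyWord

-- `dim` is D at the empty word and D + a(l) at a single edge, so both can be read off from it; the
-- resulting equation no longer mentions the D and a that exist only under double negation.
linear⇒edgeWeight : ∀ {L D} {a : L → ℕ} {dim : DyckWord L → ℕ} → (∀ w → dim w ≡ D ℕ.+ edgeWeight a (proj₂ w)) → ∀ w →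
                    dim w ≡ dim emptyWord ℕ.+ edgeWeight (λ l → dim (singleEdge l) ℕ.∸ dim emptyWord) (proj₂ w)
linear⇒edgeWeight {D = D} {a} {dim} e w = begin
  dim w                                   ≡⟨ e w ⟩
  D ℕ.+ edgeWeight a (proj₂ w)            ≡⟨ ≡.cong₂ ℕ._+_ dim-empty (edgeWeight-cong label-weight (proj₂ w)) ⟨
  dim emptyWord ℕ.+ edgeWeight (λ l → dim (singleEdge l) ℕ.∸ dim emptyWord) (proj₂ w) ∎
  where
  open ≡.≡-Reasoning
  dim-empty : dim emptyWord ≡ D
  dim-empty = ≡.trans (e emptyWord) (ℕₚ.+-identityʳ D)

  label-weight : ∀ l → dim (singleEdge l) ℕ.∸ dim emptyWord ≡ a l
  label-weight l = begin
    dim (singleEdge l) ℕ.∸ dim emptyWord   ≡⟨ ≡.cong₂ ℕ._∸_ (e (singleEdge l)) dim-empty ⟩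
    D ℕ.+ (a l ℕ.+ 0) ℕ.∸ D                ≡⟨ ℕₚ.m+n∸m≡n D (a l ℕ.+ 0) ⟩
    a l ℕ.+ 0                              ≡⟨ ℕₚ.+-identityʳ (a l) ⟩
    a l                                    ∎

module _ {c ℓ₁ ℓ₂ r ℓr p} (k : HeytingField c ℓ₁ ℓ₂) {R : CommutativeRing r ℓr}
  (σ : RingHomomorphism (CommutativeRing.rawRing (HeytingDimension.K k)) (CommutativeRing.rawRing R))
  {s : ℕ} (S : Fin s → Ideal R p) where

  open HeytingDimension k using (K; submodule-dimension)

  splines-¬¬dimension : ¬ ¬ ∃ (HasDimension (restrictScalars {A = K} σ (⟨module⟩ {R = R}))) →
    ¬ ¬ (∃₂ λ D a → ∀ w → HasDimension (restrictScalars {A = K} σ (Spl R S (treeOf w))) (D ℕ.+ edgeWeight a (proj₂ w)))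
  splines-¬¬dimension R-¬¬dimension ¬∃ = R-¬¬dimension λ (D , R-dimension) →
    ¬¬-∀ (λ l → submodule-dimension (restrictSubmodule {A = K} σ (S l)) R-dimension) λ S-dimension →
      ¬∃ (D , proj₁ ∘ S-dimension , splines-dimension (proj₂ ∘ S-dimension) R-dimension)
    where open SplineDimensions {K = K} R σ S

module _ {c ℓ₁ ℓ₂ p} (k : HeytingField c ℓ₁ ℓ₂) (n d : ℕ)
  {s : ℕ} (S : Fin s → Ideal (truncatedPolynomials k n d) p) where

  open HeytingDimension k using (dimension-unique)

  linear-splineDimension : ¬ ¬ (∃₂ λ D a → SplineDimension k n d S (λ w → D ℕ.+ edgeWeight a (proj₂ w)))
  linear-splineDimension = splines-¬¬dimension k
    {R = truncatedPolynomials k n d} (structureMap k n d) S (truncatedPolynomials-dimension k n d)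

  -- Uniqueness of dimension compares `dim` with the formula valid under double negation, which then
  -- drops out because equality of natural numbers is decidable.
  splineDimension-linear : ∀ dim → SplineDimension k n d S dim → ∀ w →
    dim w ≡ dim emptyWord ℕ.+ edgeWeight (λ l → dim (singleEdge l) ℕ.∸ dim emptyWord) (proj₂ w)
  splineDimension-linear dim dim-correct w = decidable-stable (_ ℕₚ.≟ _)
    (¬¬-map (λ (D , a , linear) → linear⇒edgeWeight (λ w → dimension-unique (dim-correct w) (linear w)) w)
      linear-splineDimension)

theorem4p5 : ∀ {c ℓ₁ ℓ₂ p} (k : HeytingField c ℓ₁ ℓ₂) (n d : ℕ) .{{_ : NonZero n}} .{{_ : NonZero d}} →
    {s : ℕ} (S : Fin s → Ideal (truncatedPolynomials k n d) p) → Injective _≡_ SameIdeal S →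
    (¬ ¬ (∃ λ dim → SplineDimension k n d S dim)) ×
    (∀ dim → SplineDimension k n d S dim → Algebraic (hilbertDyckSeries dim))
theorem4p5 k n d {s} S _ =
  ¬¬-map (λ (D , a , linear) → (λ w → D ℕ.+ edgeWeight a (proj₂ w)) , linear) (linear-splineDimension k n d S) ,
  -- The two holes are inferred from the last argument: `dim emptyWord`, and for each label the
  -- excess of `dim` at `singleEdge`.
  λ dim dim-correct → hilbertDyckSeries-algebraic s _ _ dim (splineDimension-linear k n d S dim dim-correct)
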